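{- Let $G$ be the path graph on nodes $1,\dots,n$ ($n\ge 2$) and let $T$ be any transaction matrix on $\{1,\dots,n\}$. The dynamic program for paths (described in the context) returns an optimal solution: the fee assignment it outputs maximizes the profit $p(G,T,f_E)$ over all fee assignments $f_E\in[0,1]^E$, and the value it outputs is the corresponding maximum fee revenue $\max_{f_E}\,(p(G,T,f_E)+m)$. Its time complexity is $\mathcal{O}(n^5)$.
   Context: Setting. A transaction matrix is a symmetric matrix $T\in\mathbb{N}^{n\times n}$ ($0\in\mathbb{N}$) with zero diagonal; $T[i,j]$ is the number of transactions between $i$ and $j$ (in both directions together). The path graph $G=(V,E)$ has nodes $V=\{1,\dots,n\}$ and $m=n-1$ edges numbered $1,\dots,m$, edge $e$ joining nodes $e$ and $e+1$. A fee assignment $f_E$ gives each edge $e$ a real fee $f_e\in[0,1]$. For nodes $i<j$, $path(i,j)=\{i,i+1,\dots,j-1\}$ is the set of edges between them. The profit is $$p(G,T,f_E)=-m+\sum_{1\le i<j\le n}\ \sum_{e\in path(i,j)} f_e\cdot X_{ij}\cdot T[i,j],$$ where $X_{ij}=1$ if $\sum_{e\in path(i,j)}f_e\le 1$ and $X_{ij}=0$ otherwise (not all transactions are required to use the network). Dynamic program for paths. (1) For every $1\le i\le j\le k\le m$, compute, by going over all entries $T[u,v]$ of $T$, $$M[i,j,k]=\sum_{\substack{u,v:\ i\le u\le j<v\le k+1}}T[u,v],$$ i.e., the revenue from all transactions whose path lies within the edges $i,\dots,k$ when edge $j$ has fee $1$ and every other edge has fee $0$. (2) For every $1\le x\le y\le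 m$, with $x$ in increasing order: set $P[x,y]=M[1,x,y]$ and store the edge set $S[x,y]=\{x\}$; then for $\ell=1,\dots,x-1$: if $P[\ell,x-1]+M[\ell+1,x,y]>P[x,y]$, set $P[x,y]=P[\ell,x-1]+M[\ell+1,x,y]$ and $S[x,y]=\{x\}\cup S[\ell,x-1]$. (3) Output the value $\max_{1\le x\le y\le m}P[x,y]$ and, for a pair $(x',y')$ attaining this maximum, the fee assignment with fee $1$ on the edges in $S[x',y']$ and fee $0$ on all other edges. Running time counts elementary operations (arithmetic operations and comparisons on entries at unit cost). -}

module Defs where

open import Algebra.Bundles using (CommutativeMonoid)
open import Data.Bool.Base using (Bool; true; false; if_then_else_; _∧_; _∨_)
open import Data.Fin.Base as Fin using (Fin; toℕ)
import Data.Fin.Properties as Fin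
open import Data.Fin.Subset using (Subset; ⁅_⁆; _∪_; ⊥)
open import Data.Fin.Subset.Properties using (_∈?_)
open import Data.Integer.Base as ℤ using (ℤ; +_)
open import Data.List.Base using (List; []; _∷_; allFin; cartesianProduct; filter; foldr; map)
open import Data.Maybe.Base using (Maybe; just; nothing)
open import Data.Nat.Base using (ℕ; zero; suc; _+_; _*_; _∸_; _≤ᵇ_; _<ᵇ_; _≡ᵇ_)
open import Data.Nat.Properties using (_≤?_; _<?_)
open import Data.Product.Base using (Σ-syntax; ∃-syntax; _×_; _,_)
open import Data.Rational.Base as ℚ using (ℚ; 0ℚ)
import Data.Rational.Properties as ℚ
import Data.Nat.Solver as ℕ
import Data.Rational.Unnormalised.Base as ℚᵘ
import Data.Rational.Unnormalised.Properties as ℚᵘ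
open import Data.Unit.Base using (⊤; tt)
open import Relation.Binary.PropositionalEquality using (_≡_; refl; sym; cong; cong₂; subst)
open import Relation.Nullary.Decidable using (Dec; does; _×-dec_)

------------------------------------------------------------------------
-- Real numbers, as Bishop's regular sequences of rationals

1/suc : ℕ → ℚ
1/suc k = + 1 ℚ./ suc k

record ℝ : Set where
  constructor mkℝ
  field
    seq     : ℕ → ℚ
    regular : ∀ j k → ℚ.∣ seq j ℚ.- seq k ∣ ℚ.≤ 1/suc j ℚ.+ 1/suc k

open ℝ public

infix  4 _≤ℝ_ _≃ℝ_
infixl 6 _+ℝ_
infixr 7 _·_

_≤ℝ_ : ℝ → ℝ → Set
x ≤ℝ y = ∀ k → seq x k ℚ.≤ seq y k ℚ.+ (1/suc k ℚ.+ 1/suc k)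

_≃ℝ_ : ℝ → ℝ → Set
x ≃ℝ y = x ≤ℝ y × y ≤ℝ x

0≤1/suc : ∀ k → 0ℚ ℚ.≤ 1/suc k
0≤1/suc k = ℚ.nonNegative⁻¹ (1/suc k) {{ℚ.normalize-nonNeg 1 (suc k)}}

fromℤ : ℤ → ℝ
fromℤ z = mkℝ (λ _ → z ℚ./ 1) λ j k →
  subst (ℚ._≤ 1/suc j ℚ.+ 1/suc k)
    (cong ℚ.∣_∣ (sym (ℚ.+-inverseʳ (z ℚ./ 1))))
    (ℚ.+-mono-≤ (0≤1/suc j) (0≤1/suc k))

fromℕ : ℕ → ℝ
fromℕ k = fromℤ (+ k)

0ℝ 1ℝ : ℝ
0ℝ = fromℕ 0
1ℝ = fromℕ 1

1/suc-halve : ∀ k → 1/suc (k + suc k) ℚ.+ 1/suc (k + suc k) ≡ 1/suc k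
1/suc-halve k = ℚ.toℚᵘ-injective (begin
  ℚ.toℚᵘ (1/suc d ℚ.+ 1/suc d)           ≈⟨ ℚ.toℚᵘ-homo-+ (1/suc d) (1/suc d) ⟩
  ℚ.toℚᵘ (1/suc d) ℚᵘ.+ ℚ.toℚᵘ (1/suc d) ≈⟨ ℚᵘ.+-cong (ℚ.toℚᵘ-fromℚᵘ (ℚᵘ.mkℚᵘ (+ 1) d)) (ℚ.toℚᵘ-fromℚᵘ (ℚᵘ.mkℚᵘ (+ 1) d)) ⟩
  ℚᵘ.mkℚᵘ (+ 1) d ℚᵘ.+ ℚᵘ.mkℚᵘ (+ 1) d     ≈⟨ ℚᵘ.*≡* (cong +_ (solve 1 (λ a →
      ((con 1 :* (a :+ a) :+ con 1 :* (a :+ a)) :* a) :=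
      (con 1 :* ((a :+ a) :* (a :+ a)))) refl (suc k))) ⟩
  ℚᵘ.mkℚᵘ (+ 1) k                         ≈⟨ ℚ.toℚᵘ-fromℚᵘ (ℚᵘ.mkℚᵘ (+ 1) k) ⟨
  ℚ.toℚᵘ (1/suc k)                       ∎)
  where
  d = k + suc k
  open ℕ.+-*-Solver
  open import Relation.Binary.Reasoning.Setoid ℚᵘ.≃-setoid

-- The summands are sampled at 2k+1 so that the sum is again regular.
_+ℝ_ : ℝ → ℝ → ℝ
x +ℝ y = mkℝ (λ k → seq x (k + suc k) ℚ.+ seq y (k + suc k)) reg
  where
  reg : ∀ j k → ℚ.∣ (seq x (j + suc j) ℚ.+ seq y (j + suc j)) ℚ.-
                    (seq x (k + suc k) ℚ.+ seq y (k + suc k)) ∣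
                ℚ.≤ 1/suc j ℚ.+ 1/suc k
  reg j k = begin
    ℚ.∣ (a ℚ.+ b) ℚ.- (c ℚ.+ d) ∣
      ≡⟨ cong ℚ.∣_∣ (begin-equality
        (a ℚ.+ b) ℚ.- (c ℚ.+ d)         ≡⟨ cong ((a ℚ.+ b) ℚ.+_) (ℚ.neg-distrib-+ c d) ⟩
        (a ℚ.+ b) ℚ.+ (ℚ.- c ℚ.+ ℚ.- d) ≡⟨ interchange a b (ℚ.- c) (ℚ.- d) ⟩
        (a ℚ.- c) ℚ.+ (b ℚ.- d)         ∎) ⟩
    ℚ.∣ (a ℚ.- c) ℚ.+ (b ℚ.- d) ∣
      ≤⟨ ℚ.∣p+q∣≤∣p∣+∣q∣ (a ℚ.- c) (b ℚ.- d) ⟩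
    ℚ.∣ a ℚ.- c ∣ ℚ.+ ℚ.∣ b ℚ.- d ∣
      ≤⟨ ℚ.+-mono-≤ (regular x (j + suc j) (k + suc k)) (regular y (j + suc j) (k + suc k)) ⟩
    (p ℚ.+ q) ℚ.+ (p ℚ.+ q)
      ≡⟨ interchange p q p q ⟩
    (p ℚ.+ p) ℚ.+ (q ℚ.+ q)
      ≡⟨ cong₂ ℚ._+_ (1/suc-halve j) (1/suc-halve k) ⟩
    1/suc j ℚ.+ 1/suc k ∎
    where
    open ℚ.≤-Reasoning
    open import Algebra.Properties.CommutativeSemigroup
      (CommutativeMonoid.commutativeSemigroup ℚ.+-0-commutativeMonoid) using (interchange)
    a = seq x (j + suc j)
    b = seq y (j + suc j)
    c = seq x (k + suc k)
    d = seq y (k + suc k)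
    p = 1/suc (j + suc j)
    q = 1/suc (k + suc k)

_·_ : ℕ → ℝ → ℝ
zero  · x = 0ℝ
suc k · x = x +ℝ k · x

∑ : {A : Set} → List A → (A → ℝ) → ℝ
∑ xs g = foldr _+ℝ_ 0ℝ (map g xs)

------------------------------------------------------------------------
-- Path graph, fee assignments and profit

-- The path graph with m edges has suc m nodes.
Node Edge : ℕ → Set
Node m = Fin (suc m)
Edge m = Fin m

-- Both are numbered from 1, and edge e joins nodes e and e + 1.
#_ : ∀ {k} → Fin k → ℕ
# i = suc (toℕ i)

infix 9 #_

record TransactionMatrix (n : ℕ) : Set where
  field
    _[_,_]       : Fin n → Fin n → ℕ
    symmetric    : ∀ i j → _[_,_] i j ≡ _[_,_] j i
    zeroDiagonal : ∀ i → _[_,_] i i ≡ 0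

open TransactionMatrix public

path : ∀ {m} → Node m → Node m → List (Edge m)
path i j = filter (λ e → (# i ≤? # e) ×-dec (# e <? # j)) (allFin _)

nodePairs : ∀ m → List (Node m × Node m)
nodePairs m = filter (λ (i , j) → i Fin.<? j) (cartesianProduct (allFin (suc m)) (allFin (suc m)))

FeeAssignment : ℕ → Set
FeeAssignment m = Edge m → ℝ

Feasible : ∀ {m} → FeeAssignment m → Set
Feasible f = ∀ e → 0ℝ ≤ℝ f e × f e ≤ℝ 1ℝ

-- The case distinction defining the numbers X i j.  Classically it exists for
-- every f, and it determines those numbers.  Constructively the order of ℝ is
-- undecidable, so it is an explicit argument of the profit; bounds on the
-- profit lose nothing by this, as ¬ ¬ Usage f holds and ≤ℝ is ¬ ¬-stable.
Usage : ∀ {m} → FeeAssignment m → Set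
Usage f = ∀ i j → Dec (∑ (path i j) f ≤ℝ 1ℝ)

indicator : {A : Set} → Dec A → ℕ
indicator d = if does d then 1 else 0

profit : ∀ {m} → TransactionMatrix (suc m) → (f : FeeAssignment m) → Usage f → ℝ
profit {m} T f X =
  fromℤ (ℤ.- (+ m)) +ℝ
  ∑ (nodePairs m) λ (i , j) → ∑ (path i j) λ e → (indicator (X i j) * T [ i , j ]) · f e

MaximizesProfit : ∀ {m} → TransactionMatrix (suc m) → FeeAssignment m → Set
MaximizesProfit T f =
  Feasible f ×
  Σ[ X ∈ Usage f ] (∀ g → Feasible g → (Y : Usage g) → profit T g Y ≤ℝ profit T f X)

revenue : ∀ {m} → TransactionMatrix (suc m) → (f : FeeAssignment m) → Usage f → ℝ
revenue {m} T f X = profit T f X +ℝ fromℕ m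

IsMaxRevenue : ∀ {m} → TransactionMatrix (suc m) → ℝ → Set
IsMaxRevenue T r =
  (∃[ f ] Feasible f × Σ[ X ∈ Usage f ] r ≃ℝ revenue T f X) ×
  (∀ f → Feasible f → (X : Usage f) → revenue T f X ≤ℝ r)

------------------------------------------------------------------------
-- Programs that count their elementary operations

record Timed (A : Set) : Set where
  constructor _in-time_
  field
    value : A
    time  : ℕ

open Timed public

return : {A : Set} → A → Timed A
return a = a in-time 0

infixl 1 _>>=_ _>>_

_>>=_ : {A B : Set} → Timed A → (A → Timed B) → Timed B
p >>= k = value (k (value p)) in-time (time p + time (k (value p)))

_>>_ : {A B : Set} → Timed A → Timed B → Timed B
p >> q = p >>= λ _ → q

charge : ℕ → Timed ⊤
charge k = tt in-time k

infix 5 _+!_ _∸!_ _≤!_ _<!_ _≡!_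

_+!_ _∸!_ : ℕ → ℕ → Timed ℕ
a +! b = (a + b) in-time 1
a ∸! b = (a ∸ b) in-time 1

_≤!_ _<!_ _≡!_ : ℕ → ℕ → Timed Bool
a ≤! b = (a ≤ᵇ b) in-time 1
a <! b = (a <ᵇ b) in-time 1
a ≡! b = (a ≡ᵇ b) in-time 1

-- for x ∈ xs, starting in state s; every iteration costs 1 on top of its body.
for : {A S : Set} → List A → S → (A → S → Timed S) → Timed S
for []       s body = return s
for (x ∷ xs) s body = do
  charge 1
  s′ ← body x s
  for xs s′ body

-- Tables are stores indexed by the numbers 1, 2, …; a write costs 1.  Reads
-- are part of the operation, at most a constant number per charged operation,
-- that uses them.
Table² Table³ : Set → Set
Table² A = ℕ → ℕ → A
Table³ A = ℕ → ℕ → ℕ → A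

write² : {A : Set} → Table² A → ℕ → ℕ → A → Timed (Table² A)
write² t a b v =
  (λ a′ b′ → if (a ≡ᵇ a′) ∧ (b ≡ᵇ b′) then v else t a′ b′) in-time 1

write³ : {A : Set} → Table³ A → ℕ → ℕ → ℕ → A → Timed (Table³ A)
write³ t a b c v =
  (λ a′ b′ c′ → if (a ≡ᵇ a′) ∧ (b ≡ᵇ b′) ∧ (c ≡ᵇ c′) then v else t a′ b′ c′) in-time 1

------------------------------------------------------------------------
-- The dynamic program

EdgeSet : ℕ → Set
EdgeSet m = Subset m

-- x, x + 1, …, k and 1, …, x - 1
from below : ∀ {k} → Fin k → List (Fin k)
from  x = filter (x Fin.≤?_) (allFin _)
below x = filter (Fin._<? x) (allFin _)

-- An edge set is a bit vector, so building one costs one operation per edge.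
singleton! : ∀ {m} → Edge m → Timed (EdgeSet m)
singleton! {m} x = ⁅ x ⁆ in-time m

insert! : ∀ {m} → Edge m → EdgeSet m → Timed (EdgeSet m)
insert! {m} x s = (⁅ x ⁆ ∪ s) in-time m

module _ {m : ℕ} (T : TransactionMatrix (suc m)) where

  sumEntries : ℕ → ℕ → ℕ → Timed ℕ
  sumEntries i j k = for (cartesianProduct (allFin (suc m)) (allFin (suc m))) 0 λ (u , v) acc → do
    c₁   ← i ≤! # u
    c₂   ← # u ≤! j
    c₃   ← j <! # v
    k+1  ← k +! 1
    c₄   ← # v ≤! k+1
    if c₁ ∧ c₂ ∧ c₃ ∧ c₄ then acc +! T [ u , v ] else return acc

  computeM : Timed (Table³ ℕ)
  computeM =
    for (allFin m) (λ _ _ _ → 0) λ i M →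
    for (from i) M λ j M →
    for (from j) M λ k M → do
      s ← sumEntries (# i) (# j) (# k)
      write³ M (# i) (# j) (# k) s

Tables : ℕ → Set
Tables m = Table² ℕ × Table² (EdgeSet m)

module _ {m : ℕ} (M : Table³ ℕ) where

  tryPrevious : Edge m → Edge m → Edge m → Tables m → Timed (Tables m)
  tryPrevious x y ℓ (P , S) = do
    x-1    ← # x ∸! 1
    ℓ+1    ← # ℓ +! 1
    c      ← P (# ℓ) x-1 +! M ℓ+1 (# x) (# y)
    better ← P (# x) (# y) <! c
    if better
      then (do
        P′ ← write² P (# x) (# y) c
        s  ← insert! x (S (# ℓ) x-1)
        S′ ← write² S (# x) (# y) s
        return (P′ , S′))
      else return (P , S)

  computePS : Timed (Tables m)
  computePS =
    for (allFin m) ((λ _ _ → 0) , (λ _ _ → ⊥)) λ x PS →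
    for (from x) PS λ y (P , S) → do
      P′ ← write² P (# x) (# y) (M 1 (# x) (# y))
      s  ← singleton! x
      S′ ← write² S (# x) (# y) s
      for (below x) (P′ , S′) (tryPrevious x y)

-- Which pair attaining the maximum is returned is left open: when the current
-- pair ties with the best pair found so far, an arbitrary rule decides whether
-- to replace the latter.  Every maximizing pair is returned for some rule.
TieRule : ℕ → Set
TieRule m = (current best : Edge m × Edge m) → Bool

selectMax : ∀ {m} → TieRule m → Table² ℕ → Timed (Maybe (Edge m × Edge m))
selectMax {m} tie P =
  for (allFin m) nothing λ x best →
  for (from x) best λ y → λ where
    nothing          → return (just (x , y))
    (just (x′ , y′)) → do
      better ← P (# x′) (# y′) <! P (# x) (# y)
      equal  ← P (# x′) (# y′) ≡! P (# x) (# y)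
      return (just (if better ∨ (equal ∧ tie (x , y) (x′ , y′)) then (x , y) else (x′ , y′)))

feesOf! : ∀ {m} → EdgeSet m → Timed (FeeAssignment m)
feesOf! {m} s = (λ e → if does (e ∈? s) then 1ℝ else 0ℝ) in-time m

-- The case `nothing` arises only when there is no edge.
output! : ∀ {m} → Tables m → Maybe (Edge m × Edge m) → Timed (ℕ × FeeAssignment m)
output! (P , S) (just (x , y)) = do
  f ← feesOf! (S (# x) (# y))
  return (P (# x) (# y) , f)
output! _ nothing = do
  f ← feesOf! ⊥
  return (0 , f)

dynamicProgram : ∀ {m} → TieRule m → TransactionMatrix (suc m) → Timed (ℕ × FeeAssignment m)
dynamicProgram tie T = do
  M       ← computeM T
  (P , S) ← computePS M
  best    ← selectMax tie P
  output! (P , S) best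

-- Fees in {0, 1} suffice.  Lay the edges one after another on a line, edge e
-- having length f e, and give fee 1 to the edges that contain a point of θ + ℤ.
-- A path of length at most 1 contains at most one such point and, for uniformly
-- random θ, contains one with probability equal to its length; so the expected
-- revenue of the rounded fees is at least the revenue of f.  As the order of ℝ
-- is undecidable, the argument is run on integers a e such that a e / (K + 1)
-- approximates f e from below, and K tends to infinity.  For fees in {0, 1} a
-- transaction pays iff its path has exactly one edge of fee 1; splitting the
-- paying transactions at the last such edge x, with predecessor ℓ, gives the
-- recurrence for P.

module Submission where

open import Defs
open import Algebra.Bundles using (CommutativeMonoid)
import Data.Bool.Base as Bool
open import Data.Bool.Base using (Bool; if_then_else_; true; false; _∧_; _∨_)
open import Data.Fin.Base as Fin using (Fin; toℕ; fromℕ<)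
import Data.Fin.Properties as Fin
open import Data.Fin.Subset using (⁅_⁆; _∪_; ⊥) renaming (_∈_ to _∈ₛ_)
open import Data.Fin.Subset.Properties using (_∈?_; ∉⊥; x∈⁅x⁆; x∈⁅y⁆⇒x≡y; p⊆p∪q; q⊆p∪q; x∈p∪q⁻)
import Data.Integer.Base as ℤ
import Data.Integer.Properties as ℤ
open import Data.List.Base using (List; []; _∷_; map; filter; allFin; length; tabulate; cartesianProduct)
open import Data.List.Properties using (length-tabulate; map-tabulate; length-filter; length-++; length-map)
open import Data.List.Membership.Propositional using (_∈_)
open import Data.List.Membership.Propositional.Properties using (∈-allFin; ∈-filter⁺; ∈-filter⁻)
open import Data.List.Relation.Unary.Any using (here; there)
open import Data.Maybe.Base using (Maybe; just; nothing)
open import Data.Nat.Base using (ℕ; zero; suc; _+_; _*_; _∸_; _/_; _^_; _≤_; _<_; _<ᵇ_; _≡ᵇ_; z≤n; s≤s)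
import Data.Nat.Divisibility as ℕ
import Data.Nat.DivMod as ℕ
open import Data.Nat.ListAction using (sum)
import Data.Nat.Properties as ℕ
open import Data.Nat.Properties using (_≤?_; _<?_)
open import Data.Product.Base using (_×_; Σ-syntax; ∃-syntax; _,_; proj₁; proj₂)
open import Data.Rational.Base as ℚ using (ℚ; 0ℚ; mkℚ)
import Data.Rational.Properties as ℚ
open import Data.Rational.Solver using (module +-*-Solver)
import Data.Rational.Unnormalised.Base as ℚᵘ
import Data.Rational.Unnormalised.Properties as ℚᵘ
open import Data.Sum.Base using (_⊎_; inj₁; inj₂)
open import Data.Unit.Base using (⊤; tt)
open import Function.Base using (_∘_; id)
open import Relation.Binary.PropositionalEquality
  using (_≡_; _≢_; refl; sym; trans; cong; cong₂; subst; subst₂; module ≡-Reasoning)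
open import Relation.Nullary using (Dec; does; yes; no; ¬_; contradiction)
import Relation.Nullary.Decidable as Dec
open import Relation.Nullary.Decidable using (_×-dec_)
import Algebra.Properties.CommutativeSemigroup
  (CommutativeMonoid.commutativeSemigroup ℚ.+-0-commutativeMonoid) as ℚ-+
import Algebra.Properties.CommutativeSemigroup ℕ.+-commutativeSemigroup as ℕ-+

-- Rational bounds on real numbers

-- The optimum is squeezed between two one-sided invariants of the tables. Soundness: every cell of
-- `P`, filled or not, is at most what the edge set in the same cell of `S` collects. Completeness:
-- the filled cells satisfy the recurrence as inequalities, which bounds what any weighting
-- collects. No cell has to be recognised as a maximum, and no optimal assignment has to be known to
-- exist beforehand.
--
-- Approximation from below is dictated by the threshold in X: a used path must keep integer length
-- at most K + 1, or it could receive two cuts. The opposite error, at most 3 units per edge, enters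
-- the revenue with a coefficient independent of K, so it disappears after division by K + 1. The
-- exact form of the expectation over θ is Hermite's identity: the sum of floor((a + i) / n) over i
-- < n is a.
--
-- Comparisons of reals pass through `Upper` and `Lower`, which bound a real by a rational with
-- denominator K + 1 and are compatible with sums; all combinatorics then takes place in ℕ.

infix 7 _/suc_

_/suc_ : ℕ → ℕ → ℚ
n /suc k = ℤ.+ n ℚ./ suc k

toℚᵘ-/suc : ∀ n k → ℚ.toℚᵘ (n /suc k) ℚᵘ.≃ ℚᵘ.mkℚᵘ (ℤ.+ n) k
toℚᵘ-/suc n k = ℚ.toℚᵘ-fromℚᵘ (ℚᵘ.mkℚᵘ (ℤ.+ n) k)

/suc-+ : ∀ a b k → (a + b) /suc k ≡ a /suc k ℚ.+ b /suc k
/suc-+ a b k = ℚ.toℚᵘ-injective (begin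
  ℚ.toℚᵘ ((a + b) /suc k)                  ≈⟨ toℚᵘ-/suc (a + b) k ⟩
  ℚᵘ.mkℚᵘ (ℤ.+ (a + b)) k                    ≈⟨ ℚᵘ.*≡* eqᶻ ⟩
  ℚᵘ.mkℚᵘ (ℤ.+ a) k ℚᵘ.+ ℚᵘ.mkℚᵘ (ℤ.+ b) k     ≈⟨ ℚᵘ.+-cong (toℚᵘ-/suc a k) (toℚᵘ-/suc b k) ⟨
  ℚ.toℚᵘ (a /suc k) ℚᵘ.+ ℚ.toℚᵘ (b /suc k) ≈⟨ ℚ.toℚᵘ-homo-+ (a /suc k) (b /suc k) ⟨
  ℚ.toℚᵘ (a /suc k ℚ.+ b /suc k)           ∎)
  where
  open import Relation.Binary.Reasoning.Setoid ℚᵘ.≃-setoid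
  eq : (a + b) * (suc k * suc k) ≡ (a * suc k + b * suc k) * suc k
  eq = trans (sym (ℕ.*-assoc (a + b) (suc k) (suc k))) (cong (_* suc k) (ℕ.*-distribʳ-+ (suc k) a b))
  eqᶻ : (ℤ.+ (a + b)) ℤ.* (ℤ.+ (suc k * suc k)) ≡
        ((ℤ.+ a) ℤ.* (ℤ.+ suc k) ℤ.+ (ℤ.+ b) ℤ.* (ℤ.+ suc k)) ℤ.* (ℤ.+ suc k)
  eqᶻ = trans (sym (ℤ.pos-* (a + b) (suc k * suc k))) (trans (cong ℤ.+_ eq)
    (trans (ℤ.pos-* (a * suc k + b * suc k) (suc k))
      (cong (ℤ._* (ℤ.+ suc k)) (cong₂ ℤ._+_ (ℤ.pos-* a (suc k)) (ℤ.pos-* b (suc k))))))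

/suc-mono : ∀ a k b l → a * suc l ≤ b * suc k → a /suc k ℚ.≤ b /suc l
/suc-mono a k b l h = ℚ.toℚᵘ-cancel-≤
  (ℚᵘ.≤-respˡ-≃ (ℚᵘ.≃-sym (toℚᵘ-/suc a k)) (ℚᵘ.≤-respʳ-≃ (ℚᵘ.≃-sym (toℚᵘ-/suc b l))
    (ℚᵘ.*≤* (subst₂ ℤ._≤_ (ℤ.pos-* a (suc l)) (ℤ.pos-* b (suc k)) (ℤ.+≤+ h)))))

/suc-cancel : ∀ a k b l → a /suc k ℚ.≤ b /suc l → a * suc l ≤ b * suc k
/suc-cancel a k b l h = ℤ.drop‿+≤+
  (subst₂ ℤ._≤_ (sym (ℤ.pos-* a (suc l))) (sym (ℤ.pos-* b (suc k)))
    (ℚᵘ.drop-*≤* (ℚᵘ.≤-respˡ-≃ (toℚᵘ-/suc a k) (ℚᵘ.≤-respʳ-≃ (toℚᵘ-/suc b l) (ℚ.toℚᵘ-mono-≤ h)))))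

/suc-cong : ∀ a k b l → a * suc l ≡ b * suc k → a /suc k ≡ b /suc l
/suc-cong a k b l h =
  ℚ.≤-antisym (/suc-mono a k b l (ℕ.≤-reflexive h)) (/suc-mono b l a k (ℕ.≤-reflexive (sym h)))

1/suc≤positive : ∀ p → 0ℚ ℚ.< p → ∃[ k ] 1 /suc k ℚ.≤ p
1/suc≤positive p@(mkℚ (ℤ.+ suc n) k _) _ = k ,
  ℚ.toℚᵘ-cancel-≤ (ℚᵘ.≤-respˡ-≃ (ℚᵘ.≃-sym (toℚᵘ-/suc 1 k))
    (ℚᵘ.*≤* (subst₂ ℤ._≤_ (ℤ.pos-* 1 (suc k)) (ℤ.pos-* (suc n) (suc k))
      (ℤ.+≤+ (ℕ.*-monoˡ-≤ (suc k) (s≤s (z≤n {n})))))))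
1/suc≤positive (mkℚ (ℤ.+ zero) k _) (ℚ.*<* (ℤ.+<+ ()))
1/suc≤positive (mkℚ ℤ.-[1+ n ] k _) (ℚ.*<* ())

p≤p+1/suc : ∀ p k → p ℚ.≤ p ℚ.+ 1/suc k
p≤p+1/suc p k = subst (ℚ._≤ p ℚ.+ 1/suc k) (ℚ.+-identityʳ p) (ℚ.+-monoʳ-≤ p (0≤1/suc k))

≤ℝ-refl : ∀ x → x ≤ℝ x
≤ℝ-refl x k = ℚ.≤-trans (p≤p+1/suc (seq x k) k) (ℚ.+-monoʳ-≤ (seq x k) (p≤p+1/suc (1/suc k) k))

archimedean : ∀ c {p q} → (∀ j → p ℚ.≤ q ℚ.+ c /suc j) → p ℚ.≤ q
archimedean c {p} {q} h with p ℚ.≤? q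
... | yes p≤q = p≤q
... | no  p≰q = contradiction
  (/suc-cancel 1 k c j (ℚ.≤-trans 1/k≤p-q p-q≤c/j))
  (ℕ.<⇒≱ (subst (c * suc k <_) (sym (ℕ.*-identityˡ (suc j))) (ℕ.m<n+m (c * suc k) (s≤s z≤n))))
  where
  open +-*-Solver
  0<p-q : 0ℚ ℚ.< p ℚ.- q
  0<p-q = subst (ℚ._< p ℚ.- q) (ℚ.+-inverseʳ q) (ℚ.+-monoˡ-< (ℚ.- q) (ℚ.≰⇒> p≰q))
  k = proj₁ (1/suc≤positive (p ℚ.- q) 0<p-q)
  1/k≤p-q = proj₂ (1/suc≤positive (p ℚ.- q) 0<p-q)
  -- Chosen so that `suc j` is (c + 1)(k + 1), which makes c / (j + 1) smaller than 1 / (k + 1).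
  j = k + c * suc k
  p-q≤c/j : p ℚ.- q ℚ.≤ c /suc j
  p-q≤c/j = subst (p ℚ.- q ℚ.≤_)
    (solve 2 (λ q r → (q :+ r) :- q := r) refl q (c /suc j))
    (ℚ.+-monoˡ-≤ (ℚ.- q) (h j))

seq-≤ : ∀ x j k → seq x j ℚ.≤ seq x k ℚ.+ (1/suc j ℚ.+ 1/suc k)
seq-≤ x j k = subst₂ ℚ._≤_
  (solve 2 (λ a b → b :+ (a :- b) := a) refl (seq x j) (seq x k)) refl
  (ℚ.+-monoʳ-≤ (seq x k) (ℚ.≤-trans (p≤∣p∣ (seq x j ℚ.- seq x k)) (regular x j k)))
  where
  open +-*-Solver
  p≤∣p∣ : ∀ p → p ℚ.≤ ℚ.∣ p ∣
  p≤∣p∣ p with ℚ.≤-total 0ℚ p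
  ... | inj₁ 0≤p = ℚ.≤-reflexive (sym (ℚ.0≤p⇒∣p∣≡p 0≤p))
  ... | inj₂ p≤0 = ℚ.≤-trans p≤0 (ℚ.0≤∣p∣ p)

-- The slack is the largest distance between a regular sequence's sample k and its limit. It is
-- preserved by `_+ℝ_`, whose samples at 2k + 1 carry half the slack each.
record Upper (K : ℕ) (x : ℝ) (n : ℕ) : Set where
  constructor upper
  field seq-≤-bound : ∀ k → seq x k ℚ.≤ n /suc K ℚ.+ 1/suc k

record Lower (K : ℕ) (x : ℝ) (n : ℕ) : Set where
  constructor lower
  field bound-≤-seq : ∀ k → n /suc K ℚ.≤ seq x k ℚ.+ 1/suc k

-- Regularity replaces sample k by a far sample j; every term in 1 / (j + 1) then vanishes as j
-- grows, and only the slack of k survives.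
upper-limit : ∀ c p x → (∀ j → seq x j ℚ.≤ p ℚ.+ c /suc j) → ∀ k → seq x k ℚ.≤ p ℚ.+ 1/suc k
upper-limit c p x h k = archimedean (1 + c) λ j → begin
  seq x k                                      ≤⟨ seq-≤ x k j ⟩
  seq x j ℚ.+ (1/suc k ℚ.+ 1/suc j)            ≤⟨ ℚ.+-monoˡ-≤ (1/suc k ℚ.+ 1/suc j) (h j) ⟩
  p ℚ.+ c /suc j ℚ.+ (1/suc k ℚ.+ 1/suc j)
    ≡⟨ solve 4 (λ p c k j → p :+ c :+ (k :+ j) := p :+ k :+ (j :+ c)) refl p (c /suc j) (1/suc k) (1/suc j) ⟩
  p ℚ.+ 1/suc k ℚ.+ (1/suc j ℚ.+ c /suc j)     ≡⟨ cong (p ℚ.+ 1/suc k ℚ.+_) (/suc-+ 1 c j) ⟨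
  p ℚ.+ 1/suc k ℚ.+ (1 + c) /suc j             ∎
  where open ℚ.≤-Reasoning; open +-*-Solver

lower-limit : ∀ c p x → (∀ j → p ℚ.≤ seq x j ℚ.+ c /suc j) → ∀ k → p ℚ.≤ seq x k ℚ.+ 1/suc k
lower-limit c p x h k = archimedean (1 + c) λ j → begin
  p                                                    ≤⟨ h j ⟩
  seq x j ℚ.+ c /suc j                                 ≤⟨ ℚ.+-monoˡ-≤ (c /suc j) (seq-≤ x j k) ⟩
  seq x k ℚ.+ (1/suc j ℚ.+ 1/suc k) ℚ.+ c /suc j
    ≡⟨ solve 4 (λ p c k j → p :+ (j :+ k) :+ c := p :+ k :+ (j :+ c)) refl (seq x k) (c /suc j) (1/suc k) (1/suc j) ⟩
  seq x k ℚ.+ 1/suc k ℚ.+ (1/suc j ℚ.+ c /suc j)       ≡⟨ cong (seq x k ℚ.+ 1/suc k ℚ.+_) (/suc-+ 1 c j) ⟨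
  seq x k ℚ.+ 1/suc k ℚ.+ (1 + c) /suc j               ∎
  where open ℚ.≤-Reasoning; open +-*-Solver

Upper⇒≤ : ∀ {x n} → Upper 0 x n → x ≤ℝ fromℕ n
Upper⇒≤ {x} {n} (upper h) k = ℚ.≤-trans (h k) (ℚ.+-monoʳ-≤ (n /suc 0) (p≤p+1/suc (1/suc k) k))

Lower⇒≤ : ∀ {x n} → Lower 0 x n → fromℕ n ≤ℝ x
Lower⇒≤ {x} {n} (lower h) k = ℚ.≤-trans (h k) (ℚ.+-monoʳ-≤ (seq x k) (p≤p+1/suc (1/suc k) k))

≤⇒Upper : ∀ {x n} → x ≤ℝ fromℕ n → Upper 0 x n
≤⇒Upper {x} {n} h = upper (upper-limit 2 (n /suc 0) x λ j →
  subst (λ r → seq x j ℚ.≤ n /suc 0 ℚ.+ r) (sym (/suc-+ 1 1 j)) (h j))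

Lower∧Upper⇒≤ : ∀ {K L x a b} → Lower K x a → Upper L x b → a * suc L ≤ b * suc K
Lower∧Upper⇒≤ {K} {L} {x} {a} {b} (lower l) (upper u) = /suc-cancel a K b L (archimedean 2 λ j → begin
  a /suc K                                ≤⟨ l j ⟩
  seq x j ℚ.+ 1/suc j                     ≤⟨ ℚ.+-monoˡ-≤ (1/suc j) (u j) ⟩
  b /suc L ℚ.+ 1/suc j ℚ.+ 1/suc j        ≡⟨ ℚ.+-assoc (b /suc L) (1/suc j) (1/suc j) ⟩
  b /suc L ℚ.+ (1/suc j ℚ.+ 1/suc j)      ≡⟨ cong (b /suc L ℚ.+_) (/suc-+ 1 1 j) ⟨
  b /suc L ℚ.+ 2 /suc j                   ∎)
  where open ℚ.≤-Reasoning

Lower∧≤1⇒≤ : ∀ {K x a} → Lower K x a → x ≤ℝ 1ℝ → a ≤ suc K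
Lower∧≤1⇒≤ {K} {x} {a} l x≤1 =
  subst₂ _≤_ (ℕ.*-identityʳ a) (ℕ.*-identityˡ (suc K)) (Lower∧Upper⇒≤ l (≤⇒Upper {x} {1} x≤1))

-- The passage to the limit in K. It works because the error `c` is fixed before K.
Upper-limit : ∀ {x n} c → (∀ K → Upper K x (n * suc K + c)) → Upper 0 x n
Upper-limit {x} {n} c h = upper λ k → archimedean c λ K → begin
  seq x k                                          ≤⟨ Upper.seq-≤-bound (h K) k ⟩
  (n * suc K + c) /suc K ℚ.+ 1/suc k               ≡⟨ cong (ℚ._+ 1/suc k) (/suc-+ (n * suc K) c K) ⟩
  (n * suc K) /suc K ℚ.+ c /suc K ℚ.+ 1/suc k      ≡⟨ cong (λ r → r ℚ.+ c /suc K ℚ.+ 1/suc k) (n[K+1]/[K+1]≡n K) ⟩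
  n /suc 0 ℚ.+ c /suc K ℚ.+ 1/suc k
    ≡⟨ solve 3 (λ n c k → n :+ c :+ k := n :+ k :+ c) refl (n /suc 0) (c /suc K) (1/suc k) ⟩
  n /suc 0 ℚ.+ 1/suc k ℚ.+ c /suc K                ∎
  where
  open ℚ.≤-Reasoning
  open +-*-Solver
  n[K+1]/[K+1]≡n : ∀ K → (n * suc K) /suc K ≡ n /suc 0
  n[K+1]/[K+1]≡n K = /suc-cong (n * suc K) K n 0 (ℕ.*-identityʳ (n * suc K))

module _ {K : ℕ} where

  Upper-mono : ∀ {x a b} → a ≤ b → Upper K x a → Upper K x b
  Upper-mono {a = a} {b} a≤b (upper h) = upper λ k → ℚ.≤-trans (h k)
    (ℚ.+-monoˡ-≤ (1/suc k) (/suc-mono a K b K (ℕ.*-monoˡ-≤ (suc K) a≤b)))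

  Lower-anti : ∀ {x a b} → b ≤ a → Lower K x a → Lower K x b
  Lower-anti {a = a} {b} b≤a (lower h) = lower λ k →
    ℚ.≤-trans (/suc-mono b K a K (ℕ.*-monoˡ-≤ (suc K) b≤a)) (h k)

  0-Upper : Upper K 0ℝ 0
  0-Upper = upper λ k → subst (λ p → 0ℚ ℚ.≤ p ℚ.+ 1/suc k) (sym (ℚ.0/n≡0 (suc K)))
    (p≤p+1/suc 0ℚ k)

  0-Lower : ∀ {x} → 0ℝ ≤ℝ x → Lower K x 0
  0-Lower {x} 0≤x = lower λ k → subst (ℚ._≤ seq x k ℚ.+ 1/suc k) (sym (ℚ.0/n≡0 (suc K)))
    (lower-limit 2 0ℚ x (λ j → subst (λ r → 0ℚ ℚ.≤ seq x j ℚ.+ r) (sym (/suc-+ 1 1 j)) (0≤x j)) k)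

  +-Upper : ∀ {x y a b} → Upper K x a → Upper K y b → Upper K (x +ℝ y) (a + b)
  +-Upper {x} {y} {a} {b} (upper p) (upper q) = upper λ k → let d = k + suc k in
    subst (seq (x +ℝ y) k ℚ.≤_)
      (trans (ℚ-+.interchange (a /suc K) (1/suc d) (b /suc K) (1/suc d))
        (cong₂ ℚ._+_ (sym (/suc-+ a b K)) (1/suc-halve k)))
      (ℚ.+-mono-≤ (p d) (q d))

  +-Lower : ∀ {x y a b} → Lower K x a → Lower K y b → Lower K (x +ℝ y) (a + b)
  +-Lower {x} {y} {a} {b} (lower p) (lower q) = lower λ k → let d = k + suc k in
    subst₂ ℚ._≤_ (sym (/suc-+ a b K))
      (trans (ℚ-+.interchange (seq x d) (1/suc d) (seq y d) (1/suc d))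
        (cong (seq (x +ℝ y) k ℚ.+_) (1/suc-halve k)))
      (ℚ.+-mono-≤ (p d) (q d))

  ·-Upper : ∀ k {x a} → Upper K x a → Upper K (k · x) (k * a)
  ·-Upper zero    p = 0-Upper
  ·-Upper (suc k) p = +-Upper p (·-Upper k p)

  ·-Lower : ∀ k {x a} → Lower K x a → Lower K (k · x) (k * a)
  ·-Lower zero    p = 0-Lower (≤ℝ-refl 0ℝ)
  ·-Lower (suc k) p = +-Lower p (·-Lower k p)

  ∑-Upper : ∀ {A : Set} (xs : List A) {g : A → ℝ} {h : A → ℕ} →
            (∀ x → Upper K (g x) (h x)) → Upper K (∑ xs g) (sum (map h xs))
  ∑-Upper []       p = 0-Upper
  ∑-Upper (x ∷ xs) p = +-Upper (p x) (∑-Upper xs p)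

  ∑-Lower : ∀ {A : Set} (xs : List A) {g : A → ℝ} {h : A → ℕ} →
            (∀ x → Lower K (g x) (h x)) → Lower K (∑ xs g) (sum (map h xs))
  ∑-Lower []       p = 0-Lower (≤ℝ-refl 0ℝ)
  ∑-Lower (x ∷ xs) p = +-Lower (p x) (∑-Lower xs p)

  private
    -- The bracket around `q` is shifted up by one unit, the unit that regularity costs when `q` is
    -- a sample. At `a ≡ 0` the search supplies no lower bound; nonnegativity of the real replaces
    -- it.
    search : ∀ q b → q ℚ.≤ (2 + b) /suc K →
             ∃[ a ] (a ≡ 0 ⊎ (1 + a) /suc K ℚ.≤ q) × q ℚ.≤ (2 + a) /suc K
    search q zero    h = 0 , inj₁ refl , h
    search q (suc b) h with ℚ.≤-total q ((2 + b) /suc K)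
    ... | inj₁ q≤ = search q b q≤
    ... | inj₂ ≤q = suc b , inj₂ ≤q , h

  -- seq x K is off by at most 1 / (K + 1) in either direction, and rounding it
  -- down to a multiple of 1 / (K + 1) accounts for the third unit.
  approximation : ∀ x → 0ℝ ≤ℝ x → x ≤ℝ 1ℝ → ∃[ a ] Lower K x a × Upper K x (a + 3)
  approximation x 0≤x x≤1 = a , bound-below (proj₁ (proj₂ found)) , upper bound-above
    where
    seq≤ : seq x K ℚ.≤ (2 + suc K) /suc K
    seq≤ = begin
      seq x K                                   ≤⟨ x≤1 K ⟩
      1 /suc 0 ℚ.+ (1/suc K ℚ.+ 1/suc K)        ≡⟨ cong₂ ℚ._+_ 1≡[K+1]/[K+1] (sym (/suc-+ 1 1 K)) ⟩
      suc K /suc K ℚ.+ 2 /suc K                 ≡⟨ /suc-+ (suc K) 2 K ⟨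
      (suc K + 2) /suc K                        ≡⟨ cong (_/suc K) (ℕ.+-comm (suc K) 2) ⟩
      (2 + suc K) /suc K                        ∎
      where
      open ℚ.≤-Reasoning
      1≡[K+1]/[K+1] : 1 /suc 0 ≡ suc K /suc K
      1≡[K+1]/[K+1] = /suc-cong 1 0 (suc K) K
        (trans (ℕ.*-identityˡ (suc K)) (sym (ℕ.*-identityʳ (suc K))))
    found : ∃[ a ] (a ≡ 0 ⊎ (1 + a) /suc K ℚ.≤ seq x K) × seq x K ℚ.≤ (2 + a) /suc K
    found = search (seq x K) (suc K) seq≤
    a : ℕ
    a = proj₁ found
    up : seq x K ℚ.≤ (2 + a) /suc K
    up = proj₂ (proj₂ found)
    open +-*-Solver
    bound-below : a ≡ 0 ⊎ (1 + a) /suc K ℚ.≤ seq x K → Lower K x a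
    bound-below (inj₁ a≡0) = subst (Lower K x) (sym a≡0) (0-Lower 0≤x)
    bound-below (inj₂ h) = lower λ k → subst₂ ℚ._≤_
      (trans (cong (ℚ._- 1/suc K) (/suc-+ 1 a K)) (solve 2 (λ e a → e :+ a :- e := a) refl (1/suc K) (a /suc K)))
      (solve 3 (λ s e k → s :+ (e :+ k) :- e := s :+ k) refl (seq x k) (1/suc K) (1/suc k))
      (ℚ.+-monoˡ-≤ (ℚ.- 1/suc K) (ℚ.≤-trans h (seq-≤ x K k)))
    bound-above : ∀ k → seq x k ℚ.≤ (a + 3) /suc K ℚ.+ 1/suc k
    bound-above k = begin
      seq x k                                           ≤⟨ seq-≤ x k K ⟩
      seq x K ℚ.+ (1/suc k ℚ.+ 1/suc K)                 ≤⟨ ℚ.+-monoˡ-≤ (1/suc k ℚ.+ 1/suc K) up ⟩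
      (2 + a) /suc K ℚ.+ (1/suc k ℚ.+ 1/suc K)
        ≡⟨ solve 3 (λ s e k → s :+ (k :+ e) := e :+ s :+ k) refl ((2 + a) /suc K) (1/suc K) (1/suc k) ⟩
      1/suc K ℚ.+ (2 + a) /suc K ℚ.+ 1/suc k            ≡⟨ cong (ℚ._+ 1/suc k) (/suc-+ 1 (2 + a) K) ⟨
      (3 + a) /suc K ℚ.+ 1/suc k                        ≡⟨ cong (λ n → n /suc K ℚ.+ 1/suc k) (ℕ.+-comm 3 a) ⟩
      (a + 3) /suc K ℚ.+ 1/suc k                        ∎
      where open ℚ.≤-Reasoning

-- Compares two profits through an integer between their revenues; `z` is the constant -m.
Upper∧Lower⇒+≤+ : ∀ z {x y n} → Upper 0 x n → Lower 0 y n → z +ℝ x ≤ℝ z +ℝ y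
Upper∧Lower⇒+≤+ z {x} {y} (upper u) (lower l) k = begin
  seq z d ℚ.+ seq x d
    ≤⟨ ℚ.+-monoʳ-≤ (seq z d) (ℚ.≤-trans (u d) (ℚ.+-monoˡ-≤ (1/suc d) (l d))) ⟩
  seq z d ℚ.+ (seq y d ℚ.+ 1/suc d ℚ.+ 1/suc d)
    ≡⟨ solve 3 (λ z y e → z :+ (y :+ e :+ e) := z :+ y :+ (e :+ e)) refl (seq z d) (seq y d) (1/suc d) ⟩
  seq z d ℚ.+ seq y d ℚ.+ (1/suc d ℚ.+ 1/suc d)
    ≡⟨ cong (seq z d ℚ.+ seq y d ℚ.+_) (1/suc-halve k) ⟩
  seq z d ℚ.+ seq y d ℚ.+ 1/suc k
    ≤⟨ ℚ.+-monoʳ-≤ (seq z d ℚ.+ seq y d) (p≤p+1/suc (1/suc k) k) ⟩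
  seq z d ℚ.+ seq y d ℚ.+ (1/suc k ℚ.+ 1/suc k) ∎
  where
  d = k + suc k
  open ℚ.≤-Reasoning
  open +-*-Solver

module _ (m : ℕ) (x : ℝ) where

  private
    -- Two nested sums resample twice: 2k + 1, then 4k + 3.
    index : ℕ → ℕ
    index k = (k + suc k) + suc (k + suc k)

    1/suc-index : ∀ k → 1/suc (index k) ℚ.≤ 1/suc k
    1/suc-index k = /suc-mono 1 (index k) 1 k (ℕ.+-monoˡ-≤ 0
      (s≤s (ℕ.≤-trans (ℕ.m≤m+n k (suc k)) (ℕ.m≤m+n (k + suc k) _))))

    seq-cancel : ∀ k → seq (fromℤ (ℤ.- (ℤ.+ m)) +ℝ x +ℝ fromℕ m) k ≡ seq x (index k)
    seq-cancel k = trans (cong (λ r → r ℚ.+ seq x (index k) ℚ.+ m /suc 0) (neg-/1 m))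
      (solve 2 (λ m x → :- m :+ x :+ m := x) refl (m /suc 0) (seq x (index k)))
      where
      open +-*-Solver
      neg-/1 : ∀ m → (ℤ.- (ℤ.+ m)) ℚ./ 1 ≡ ℚ.- (m /suc 0)
      neg-/1 zero    = refl
      neg-/1 (suc m) = refl

  -m+x+m-Upper : ∀ {n} → Upper 0 x n → Upper 0 (fromℤ (ℤ.- (ℤ.+ m)) +ℝ x +ℝ fromℕ m) n
  -m+x+m-Upper {n} (upper u) = upper λ k →
    subst (ℚ._≤ n /suc 0 ℚ.+ 1/suc k) (sym (seq-cancel k))
      (ℚ.≤-trans (u (index k)) (ℚ.+-monoʳ-≤ (n /suc 0) (1/suc-index k)))

  -m+x+m-Lower : ∀ {n} → Lower 0 x n → Lower 0 (fromℤ (ℤ.- (ℤ.+ m)) +ℝ x +ℝ fromℕ m) n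
  -m+x+m-Lower {n} (lower l) = lower λ k →
    subst (λ r → n /suc 0 ℚ.≤ r ℚ.+ 1/suc k) (sym (seq-cancel k))
      (ℚ.≤-trans (l (index k)) (ℚ.+-monoʳ-≤ (seq x (index k)) (1/suc-index k)))

-- Finite sums of natural numbers

∑ⁿ : {A : Set} → List A → (A → ℕ) → ℕ
∑ⁿ xs g = sum (map g xs)

infix 8 [_]·_

-- The Iverson bracket. Going through `does`, it computes to the Boolean tests of `filter` and of
-- the program.
[_]·_ : {P : Set} → Dec P → ℕ → ℕ
[ d ]· n = if does d then n else 0

private variable
  A B : Set

∑ⁿ-cong : ∀ (xs : List A) {g h : A → ℕ} → (∀ x → g x ≡ h x) → ∑ⁿ xs g ≡ ∑ⁿ xs h
∑ⁿ-cong []       g≡h = refl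
∑ⁿ-cong (x ∷ xs) g≡h = cong₂ _+_ (g≡h x) (∑ⁿ-cong xs g≡h)

∑ⁿ-mono : ∀ (xs : List A) {g h : A → ℕ} → (∀ x → g x ≤ h x) → ∑ⁿ xs g ≤ ∑ⁿ xs h
∑ⁿ-mono []       g≤h = z≤n
∑ⁿ-mono (x ∷ xs) g≤h = ℕ.+-mono-≤ (g≤h x) (∑ⁿ-mono xs g≤h)

∑ⁿ-+ : ∀ (xs : List A) (g h : A → ℕ) → ∑ⁿ xs (λ x → g x + h x) ≡ ∑ⁿ xs g + ∑ⁿ xs h
∑ⁿ-+ []       g h = refl
∑ⁿ-+ (x ∷ xs) g h = trans (cong (g x + h x +_) (∑ⁿ-+ xs g h))
  (ℕ-+.interchange (g x) (h x) (∑ⁿ xs g) (∑ⁿ xs h))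

∑ⁿ-const : ∀ (xs : List A) c → ∑ⁿ xs (λ _ → c) ≡ length xs * c
∑ⁿ-const []       c = refl
∑ⁿ-const (x ∷ xs) c = cong (c +_) (∑ⁿ-const xs c)

∑ⁿ-0 : ∀ (xs : List A) → ∑ⁿ xs (λ _ → 0) ≡ 0
∑ⁿ-0 xs = trans (∑ⁿ-const xs 0) (ℕ.*-zeroʳ (length xs))

∑ⁿ-*ˡ : ∀ (xs : List A) c (g : A → ℕ) → ∑ⁿ xs (λ x → c * g x) ≡ c * ∑ⁿ xs g
∑ⁿ-*ˡ []       c g = sym (ℕ.*-zeroʳ c)
∑ⁿ-*ˡ (x ∷ xs) c g = trans (cong (c * g x +_) (∑ⁿ-*ˡ xs c g)) (sym (ℕ.*-distribˡ-+ c (g x) (∑ⁿ xs g)))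

∑ⁿ-swap : ∀ (xs : List A) (ys : List B) (g : A → B → ℕ) →
          ∑ⁿ xs (λ x → ∑ⁿ ys (g x)) ≡ ∑ⁿ ys (λ y → ∑ⁿ xs (λ x → g x y))
∑ⁿ-swap []       ys g = sym (∑ⁿ-0 ys)
∑ⁿ-swap (x ∷ xs) ys g = trans (cong (∑ⁿ ys (g x) +_) (∑ⁿ-swap xs ys g))
  (sym (∑ⁿ-+ ys (g x) (λ y → ∑ⁿ xs (λ x → g x y))))

∑ⁿ-filter : ∀ {P : A → Set} (P? : ∀ x → Dec (P x)) (xs : List A) (g : A → ℕ) →
            ∑ⁿ (filter P? xs) g ≡ ∑ⁿ xs (λ x → [ P? x ]· g x)
∑ⁿ-filter P? []       g = refl
∑ⁿ-filter P? (x ∷ xs) g with does (P? x)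
... | true  = cong (g x +_) (∑ⁿ-filter P? xs g)
... | false = ∑ⁿ-filter P? xs g

∈⇒≤∑ⁿ : ∀ {xs : List A} {x} (g : A → ℕ) → x ∈ xs → g x ≤ ∑ⁿ xs g
∈⇒≤∑ⁿ g (here refl)               = ℕ.m≤m+n _ _
∈⇒≤∑ⁿ {xs = y ∷ _} g (there x∈xs) = ℕ.≤-trans (∈⇒≤∑ⁿ g x∈xs) (ℕ.m≤n+m _ (g y))

∑ⁿ-allFin-suc : ∀ n (g : Fin (suc n) → ℕ) → ∑ⁿ (allFin (suc n)) g ≡ g Fin.zero + ∑ⁿ (allFin n) (g ∘ Fin.suc)
∑ⁿ-allFin-suc n g = cong (λ xs → g Fin.zero + sum xs)
  (trans (map-tabulate Fin.suc g) (sym (map-tabulate (λ i → i) (g ∘ Fin.suc))))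

-- Both sides are the sum of `g` over 0, ..., n; the additive form avoids subtraction.
∑ⁿ-shift : ∀ n (g : ℕ → ℕ) →
           ∑ⁿ (allFin n) (g ∘ suc ∘ toℕ) + g 0 ≡ ∑ⁿ (allFin n) (g ∘ toℕ) + g n
∑ⁿ-shift zero    g = refl
∑ⁿ-shift (suc n) g = begin
  ∑ⁿ (allFin (suc n)) (g ∘ suc ∘ toℕ) + g 0                ≡⟨ cong (_+ g 0) (∑ⁿ-allFin-suc n (g ∘ suc ∘ toℕ)) ⟩
  g 1 + ∑ⁿ (allFin n) (g ∘ suc ∘ suc ∘ toℕ) + g 0          ≡⟨ cong (_+ g 0) (ℕ.+-comm (g 1) _) ⟩
  ∑ⁿ (allFin n) (g ∘ suc ∘ suc ∘ toℕ) + g 1 + g 0          ≡⟨ cong (_+ g 0) (∑ⁿ-shift n (g ∘ suc)) ⟩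
  ∑ⁿ (allFin n) (g ∘ suc ∘ toℕ) + g (suc n) + g 0          ≡⟨ ℕ.+-comm _ (g 0) ⟩
  g 0 + (∑ⁿ (allFin n) (g ∘ suc ∘ toℕ) + g (suc n))        ≡⟨ ℕ.+-assoc (g 0) _ _ ⟨
  g 0 + ∑ⁿ (allFin n) (g ∘ suc ∘ toℕ) + g (suc n)          ≡⟨ cong (_+ g (suc n)) (∑ⁿ-allFin-suc n (g ∘ toℕ)) ⟨
  ∑ⁿ (allFin (suc n)) (g ∘ toℕ) + g (suc n)                ∎
  where open ≡-Reasoning

[]·-yes : ∀ {P : Set} (d : Dec P) {n} → P → [ d ]· n ≡ n
[]·-yes (yes _) p = refl
[]·-yes (no ¬p) p = contradiction p ¬p

[]·-no : ∀ {P : Set} (d : Dec P) {n} → ¬ P → [ d ]· n ≡ 0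
[]·-no (yes p) ¬p = contradiction p ¬p
[]·-no (no _)  ¬p = refl

[]·-cong : ∀ {P : Set} (d : Dec P) {n k} → (P → n ≡ k) → [ d ]· n ≡ [ d ]· k
[]·-cong (yes p) n≡k = n≡k p
[]·-cong (no _)  n≡k = refl

[]·-≤ : ∀ {P : Set} (d : Dec P) {n k} → (P → n ≤ k) → [ d ]· n ≤ k
[]·-≤ (yes p) n≤k = n≤k p
[]·-≤ (no _)  n≤k = z≤n

[]·-⇒ : ∀ {P Q : Set} (d : Dec P) (e : Dec Q) {n} → (P → Q) → [ d ]· n ≤ [ e ]· n
[]·-⇒ d e P⇒Q = []·-≤ d λ p → ℕ.≤-reflexive (sym ([]·-yes e (P⇒Q p)))

[]·-cover : ∀ {P Q R : Set} (d : Dec P) (e : Dec Q) (f : Dec R) {n} →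
            (P → Q ⊎ R) → [ d ]· n ≤ [ e ]· n + [ f ]· n
[]·-cover d e f {n} P⇒Q⊎R = []·-≤ d (either ∘ P⇒Q⊎R)
  where
  either : _ ⊎ _ → n ≤ [ e ]· n + [ f ]· n
  either (inj₁ q) = ℕ.≤-trans (ℕ.≤-reflexive (sym ([]·-yes e q))) (ℕ.m≤m+n _ _)
  either (inj₂ r) = ℕ.≤-trans (ℕ.≤-reflexive (sym ([]·-yes f r))) (ℕ.m≤n+m _ ([ e ]· n))

[]·-pack : ∀ {P Q R : Set} (d : Dec P) (e : Dec Q) (f : Dec R) {n} →
           (Q → P) → (R → P) → (Q → ¬ R) → [ e ]· n + [ f ]· n ≤ [ d ]· n
[]·-pack d (no _)  f       Q⇒P R⇒P Q⇒¬R = []·-⇒ f d R⇒P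
[]·-pack d (yes q) (yes r) Q⇒P R⇒P Q⇒¬R = contradiction r (Q⇒¬R q)
[]·-pack d (yes q) (no _)  Q⇒P R⇒P Q⇒¬R =
  ℕ.≤-reflexive (trans (ℕ.+-identityʳ _) (sym ([]·-yes d (Q⇒P q))))

-- Hermite's identity
∑ⁿ-[a+i]/n : ∀ a n → ∑ⁿ (allFin (suc n)) (λ i → (a + toℕ i) / suc n) ≡ a
∑ⁿ-[a+i]/n zero    n = trans (∑ⁿ-cong (allFin (suc n)) (ℕ.m<n⇒m/n≡0 ∘ Fin.toℕ<n)) (∑ⁿ-0 (allFin (suc n)))
-- Raising a by one shifts the window of numerators by one: the term a / (n + 1) leaves and (a + n +
-- 1) / (n + 1), larger by exactly 1, enters.
∑ⁿ-[a+i]/n (suc a) n = ℕ.+-cancelʳ-≡ (a / suc n) _ _ (begin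
  ∑ⁿ (allFin (suc n)) (λ i → (suc a + toℕ i) / suc n) + a / suc n
    ≡⟨ cong₂ _+_ (∑ⁿ-cong (allFin (suc n)) (λ i → cong (_/ suc n) (ℕ.+-suc a (toℕ i))))
                  (cong (_/ suc n) (ℕ.+-identityʳ a)) ⟨
  ∑ⁿ (allFin (suc n)) (g ∘ suc ∘ toℕ) + g 0
    ≡⟨ ∑ⁿ-shift (suc n) g ⟩
  ∑ⁿ (allFin (suc n)) (g ∘ toℕ) + g (suc n)
    ≡⟨ cong₂ _+_ (∑ⁿ-[a+i]/n a n)
                  (trans (ℕ.+-distrib-/-∣ʳ a {suc n} ℕ.∣-refl) (cong (a / suc n +_) (ℕ.n/n≡1 (suc n)))) ⟩
  a + (a / suc n + 1)
    ≡⟨ cong (a +_) (ℕ.+-comm (a / suc n) 1) ⟩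
  a + suc (a / suc n)
    ≡⟨ ℕ.+-suc a (a / suc n) ⟩
  suc a + a / suc n ∎)
  where
  open ≡-Reasoning
  g : ℕ → ℕ
  g i = (a + i) / suc n

-- Sums over the edges of a path

edge-at : ∀ {m} t → 1 ≤ t → t ≤ m → Σ[ e ∈ Edge m ] # e ≡ t
edge-at {m} (suc t) _ t<m = fromℕ< t<m , cong suc (Fin.toℕ-fromℕ< t<m)

-- The endpoints are plain numbers, so that a node label, an edge label or the successor of an edge
-- label can serve as a splitting point. The interval is half-open because the path to node j ends
-- with edge j - 1.
pathSum : ∀ {m} → (Edge m → ℕ) → ℕ → ℕ → ℕ
pathSum {m} b p q = ∑ⁿ (allFin m) λ e → [ (p ≤? # e) ×-dec (# e <? q) ]· b e

∑ⁿ-path : ∀ {m} (b : Edge m → ℕ) (u v : Node m) → ∑ⁿ (path u v) b ≡ pathSum b (# u) (# v)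
∑ⁿ-path {m} b u v = ∑ⁿ-filter (λ e → (# u ≤? # e) ×-dec (# e <? # v)) (allFin m) b

module _ {m : ℕ} where

  pathSum-cong : ∀ {b c : Edge m → ℕ} p q → (∀ e → p ≤ # e → # e < q → b e ≡ c e) →
                 pathSum b p q ≡ pathSum c p q
  pathSum-cong p q b≡c = ∑ⁿ-cong (allFin m) λ e →
    []·-cong ((p ≤? # e) ×-dec (# e <? q)) λ (p≤e , e<q) → b≡c e p≤e e<q

  pathSum-zero : ∀ {b : Edge m → ℕ} p q → (∀ e → p ≤ # e → # e < q → b e ≡ 0) → pathSum b p q ≡ 0
  pathSum-zero {b} p q b≡0 = trans (∑ⁿ-cong (allFin m) vanish) (∑ⁿ-0 (allFin m))
    where
    vanish : ∀ e → [ (p ≤? # e) ×-dec (# e <? q) ]· b e ≡ 0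
    vanish e = ℕ.n≤0⇒n≡0 ([]·-≤ ((p ≤? # e) ×-dec (# e <? q)) λ (p≤e , e<q) → ℕ.≤-reflexive (b≡0 e p≤e e<q))

  ∈path⇒≤pathSum : ∀ (b : Edge m → ℕ) {p q} e → p ≤ # e → # e < q → b e ≤ pathSum b p q
  ∈path⇒≤pathSum b {p} {q} e p≤e e<q = ℕ.≤-trans
    (ℕ.≤-reflexive (sym ([]·-yes ((p ≤? # e) ×-dec (# e <? q)) (p≤e , e<q))))
    (∈⇒≤∑ⁿ (λ e → [ (p ≤? # e) ×-dec (# e <? q) ]· b e) (∈-allFin e))

  pathSum-split : ∀ (b : Edge m → ℕ) {p q r} → p ≤ q → q ≤ r →
                  pathSum b p r ≡ pathSum b p q + pathSum b q r
  pathSum-split b {p} {q} {r} p≤q q≤r = trans (∑ⁿ-cong (allFin m) split)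
    (∑ⁿ-+ (allFin m) (λ e → [ (p ≤? # e) ×-dec (# e <? q) ]· b e) (λ e → [ (q ≤? # e) ×-dec (# e <? r) ]· b e))
    where
    split : ∀ e → [ (p ≤? # e) ×-dec (# e <? r) ]· b e ≡
                  [ (p ≤? # e) ×-dec (# e <? q) ]· b e + [ (q ≤? # e) ×-dec (# e <? r) ]· b e
    split e = ℕ.≤-antisym
      ([]·-cover d₁ d₂ d₃ λ (p≤e , e<r) → case p≤e e<r (q ≤? # e))
      ([]·-pack d₁ d₂ d₃ (λ (p≤e , e<q) → p≤e , ℕ.<-≤-trans e<q q≤r)
        (λ (q≤e , e<r) → ℕ.≤-trans p≤q q≤e , e<r) (λ (_ , e<q) (q≤e , _) → ℕ.<⇒≱ e<q q≤e))
      where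
      d₁ = (p ≤? # e) ×-dec (# e <? r)
      d₂ = (p ≤? # e) ×-dec (# e <? q)
      d₃ = (q ≤? # e) ×-dec (# e <? r)
      case : p ≤ # e → # e < r → Dec (q ≤ # e) → (p ≤ # e × # e < q) ⊎ (q ≤ # e × # e < r)
      case p≤e e<r (yes q≤e) = inj₂ (q≤e , e<r)
      case p≤e e<r (no q≰e)  = inj₁ (p≤e , ℕ.≰⇒> q≰e)

pathSum-edge : ∀ {m} (b : Edge m → ℕ) e → pathSum b (# e) (suc (# e)) ≡ b e
pathSum-edge {suc m} b Fin.zero = trans (∑ⁿ-allFin-suc m _)
  (trans (cong (b Fin.zero +_) (∑ⁿ-0 (allFin m))) (ℕ.+-identityʳ _))
-- The first edge fails the test, and lowering all remaining labels together with both endpoints by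
-- one leaves the tests unchanged by computation.
pathSum-edge {suc m} b (Fin.suc e) = trans
  (∑ⁿ-allFin-suc m λ e′ → [ (# Fin.suc e ≤? # e′) ×-dec (# e′ <? suc (# Fin.suc e)) ]· b e′)
  (pathSum-edge (b ∘ Fin.suc) e)

-- Rounding

-- With edge e occupying the interval (pathSum a 1 (# e) , pathSum a 1 (# e) + a e],
-- cuts θ e is the number of points z ≡ - θ (mod K + 1) on it.
module _ {m : ℕ} (a : Edge m → ℕ) (K : ℕ) where

  cutsBefore : ℕ → ℕ → ℕ
  cutsBefore θ t = (pathSum a 1 t + θ) / suc K

  cuts : ℕ → Edge m → ℕ
  cuts θ e = cutsBefore θ (suc (# e)) ∸ cutsBefore θ (# e)

  private
    pathSum-suc : ∀ e → pathSum a 1 (suc (# e)) ≡ pathSum a 1 (# e) + a e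
    pathSum-suc e = trans (pathSum-split a (s≤s z≤n) (ℕ.n≤1+n (# e)))
      (cong (pathSum a 1 (# e) +_) (pathSum-edge a e))

    cuts+cutsBefore : ∀ θ e → cuts θ e + cutsBefore θ (# e) ≡ cutsBefore θ (suc (# e))
    cuts+cutsBefore θ e = ℕ.m∸n+n≡m (ℕ./-monoˡ-≤ (suc K) (ℕ.+-monoˡ-≤ θ
      (ℕ.≤-trans (ℕ.m≤m+n _ (a e)) (ℕ.≤-reflexive (sym (pathSum-suc e))))))

    -- Each cut count is a difference of consecutive values of `cutsBefore`, so the sum collapses.
    -- Moving the initial value to the left avoids truncated subtraction.
    telescope : ∀ θ {p} k → 1 ≤ p → p + k ≤ suc m →
                pathSum (cuts θ) p (p + k) + cutsBefore θ p ≡ cutsBefore θ (p + k)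
    telescope θ {p} zero 1≤p p≤m rewrite ℕ.+-identityʳ p =
      cong (_+ cutsBefore θ p) (pathSum-zero {m} {cuts θ} p p λ e p≤e e<p → contradiction p≤e (ℕ.<⇒≱ e<p))
    telescope θ {p} (suc k) 1≤p p+k<m rewrite ℕ.+-suc p k
      with e , #e≡p+k ← edge-at (p + k) (ℕ.≤-trans 1≤p (ℕ.m≤m+n p k)) (ℕ.≤-pred p+k<m) = begin
      pathSum (cuts θ) p (suc (p + k)) + cutsBefore θ p
        ≡⟨ cong (_+ cutsBefore θ p) (pathSum-split (cuts θ) (ℕ.m≤m+n p k) (ℕ.n≤1+n (p + k))) ⟩
      pathSum (cuts θ) p (p + k) + pathSum (cuts θ) (p + k) (suc (p + k)) + cutsBefore θ p
        ≡⟨ cong (λ s → pathSum (cuts θ) p (p + k) + s + cutsBefore θ p)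
             (subst (λ t → pathSum (cuts θ) t (suc t) ≡ cuts θ e) #e≡p+k (pathSum-edge (cuts θ) e)) ⟩
      pathSum (cuts θ) p (p + k) + cuts θ e + cutsBefore θ p
        ≡⟨ cong (_+ cutsBefore θ p) (ℕ.+-comm _ (cuts θ e)) ⟩
      cuts θ e + pathSum (cuts θ) p (p + k) + cutsBefore θ p
        ≡⟨ ℕ.+-assoc (cuts θ e) _ _ ⟩
      cuts θ e + (pathSum (cuts θ) p (p + k) + cutsBefore θ p)
        ≡⟨ cong (cuts θ e +_) (telescope θ k 1≤p (ℕ.<⇒≤ p+k<m)) ⟩
      cuts θ e + cutsBefore θ (p + k)
        ≡⟨ subst (λ t → cuts θ e + cutsBefore θ t ≡ cutsBefore θ (suc t)) #e≡p+k (cuts+cutsBefore θ e) ⟩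
      cutsBefore θ (suc (p + k)) ∎
      where open ≡-Reasoning

  -- The cuts of a path are the difference of two floors whose numerators differ by at most K + 1.
  pathSum-cuts≤1 : ∀ θ {p q} → 1 ≤ p → p ≤ q → q ≤ suc m →
                   pathSum a p q ≤ suc K → pathSum (cuts θ) p q ≤ 1
  pathSum-cuts≤1 θ {p} {q} 1≤p p≤q q≤m short = ℕ.+-cancelʳ-≤ (cutsBefore θ p) _ _ (begin
    pathSum (cuts θ) p q + cutsBefore θ p
      ≡⟨ subst (λ r → pathSum (cuts θ) p r + cutsBefore θ p ≡ cutsBefore θ r) p+k≡q
           (telescope θ (q ∸ p) 1≤p (ℕ.≤-trans (ℕ.≤-reflexive p+k≡q) q≤m)) ⟩
    (pathSum a 1 q + θ) / suc K
      ≡⟨ cong (λ s → (s + θ) / suc K) (pathSum-split a 1≤p p≤q) ⟩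
    (pathSum a 1 p + pathSum a p q + θ) / suc K
      ≤⟨ ℕ./-monoˡ-≤ (suc K) (ℕ.+-monoˡ-≤ θ (ℕ.+-monoʳ-≤ (pathSum a 1 p) short)) ⟩
    (pathSum a 1 p + suc K + θ) / suc K
      ≡⟨ cong (_/ suc K) (trans (cong (_+ θ) (ℕ.+-comm _ (suc K))) (ℕ.+-assoc (suc K) _ θ)) ⟩
    (suc K + (pathSum a 1 p + θ)) / suc K
      ≡⟨ ℕ.+-distrib-/-∣ˡ {suc K} (pathSum a 1 p + θ) ℕ.∣-refl ⟩
    suc K / suc K + cutsBefore θ p
      ≡⟨ cong (_+ cutsBefore θ p) (ℕ.n/n≡1 (suc K)) ⟩
    1 + cutsBefore θ p ∎)
    where
    open ℕ.≤-Reasoning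
    p+k≡q = ℕ.m+[n∸m]≡n p≤q

  -- The exact integer form of "probability equals length": Hermite's identity at both ends of edge
  -- e, subtracted.
  ∑ⁿ-cuts : ∀ e → ∑ⁿ (allFin (suc K)) (λ i → cuts (toℕ i) e) ≡ a e
  ∑ⁿ-cuts e = ℕ.+-cancelʳ-≡ (pathSum a 1 (# e)) _ _ (begin
    ∑ⁿ θs (λ i → cuts (toℕ i) e) + pathSum a 1 (# e)
      ≡⟨ cong (∑ⁿ θs (λ i → cuts (toℕ i) e) +_) (∑ⁿ-[a+i]/n (pathSum a 1 (# e)) K) ⟨
    ∑ⁿ θs (λ i → cuts (toℕ i) e) + ∑ⁿ θs (λ i → cutsBefore (toℕ i) (# e))
      ≡⟨ ∑ⁿ-+ θs (λ i → cuts (toℕ i) e) (λ i → cutsBefore (toℕ i) (# e)) ⟨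
    ∑ⁿ θs (λ i → cuts (toℕ i) e + cutsBefore (toℕ i) (# e))
      ≡⟨ ∑ⁿ-cong θs (λ i → cuts+cutsBefore (toℕ i) e) ⟩
    ∑ⁿ θs (λ i → cutsBefore (toℕ i) (suc (# e)))
      ≡⟨ ∑ⁿ-[a+i]/n (pathSum a 1 (suc (# e))) K ⟩
    pathSum a 1 (suc (# e))
      ≡⟨ pathSum-suc e ⟩
    pathSum a 1 (# e) + a e
      ≡⟨ ℕ.+-comm _ (a e) ⟩
    a e + pathSum a 1 (# e) ∎)
    where
    open ≡-Reasoning
    θs = allFin (suc K)

-- Paying transactions and averaging over the shifts

pairs : ∀ m → List (Node m × Node m)
pairs m = cartesianProduct (allFin (suc m)) (allFin (suc m))

module _ {m : ℕ} (T : TransactionMatrix (suc m)) where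

  -- For b with values in {0, 1} these are the transactions on the first y edges
  -- that pay under the fees b.  The other values occur for b = cuts a K θ, and
  -- the recurrence for P bounds W b for all b.
  Wins : (Edge m → ℕ) → ℕ → Node m → Node m → Set
  Wins b y u v = u Fin.< v × # v ≤ suc y × pathSum b (# u) (# v) ≡ 1

  wins? : ∀ b y u v → Dec (Wins b y u v)
  wins? b y u v = (u Fin.<? v) ×-dec (# v ≤? suc y) ×-dec (pathSum b (# u) (# v) ℕ.≟ 1)

  W : (Edge m → ℕ) → ℕ → ℕ
  W b y = ∑ⁿ (pairs m) λ (u , v) → [ wins? b y u v ]· T [ u , v ]

  -- Usage and fees are separate arguments: in `rounding` the decisions come from the real fees and
  -- stay fixed while `c` runs through the cuts, so the expression is linear in `c`.
  feeSum : {Q : Node m → Node m → Set} → (∀ i j → Dec (Q i j)) → (Edge m → ℕ) → ℕ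
  feeSum X c = ∑ⁿ (nodePairs m) λ (i , j) → ∑ⁿ (path i j) λ e → (indicator (X i j) * T [ i , j ]) * c e

  feeSum-pairs : ∀ {Q : Node m → Node m → Set} (X : ∀ i j → Dec (Q i j)) c →
    feeSum X c ≡ ∑ⁿ (pairs m) λ (i , j) → [ i Fin.<? j ]· ((indicator (X i j) * T [ i , j ]) * pathSum c (# i) (# j))
  feeSum-pairs X c = trans (∑ⁿ-filter (λ (i , j) → i Fin.<? j) (pairs m) _)
    (∑ⁿ-cong (pairs m) λ (i , j) → cong ([ i Fin.<? j ]·_)
      (trans (∑ⁿ-*ˡ (path i j) (indicator (X i j) * T [ i , j ]) c)
        (cong (indicator (X i j) * T [ i , j ] *_) (∑ⁿ-path c i j))))

  -- A used path has sum 0 and contributes nothing, or sum 1 and is counted by `W`.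
  feeSum≤W : ∀ {Q : Node m → Node m → Set} (X : ∀ i j → Dec (Q i j)) b →
             (∀ i j → i Fin.< j → Q i j → pathSum b (# i) (# j) ≤ 1) → feeSum X b ≤ W b m
  feeSum≤W {Q} X b short = ℕ.≤-trans (ℕ.≤-reflexive (feeSum-pairs X b))
    (∑ⁿ-mono (pairs m) λ (i , j) → []·-≤ (i Fin.<? j) λ i<j → pointwise i j i<j (X i j) (short i j i<j))
    where
    pointwise : ∀ i j → i Fin.< j → (d : Dec (Q i j)) → (Q i j → pathSum b (# i) (# j) ≤ 1) →
                indicator d * T [ i , j ] * pathSum b (# i) (# j) ≤ [ wins? b m i j ]· T [ i , j ]
    pointwise i j i<j (no _)  short = z≤n
    pointwise i j i<j (yes q) short = atMostOne _ refl (short q)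
      where
      atMostOne : ∀ k → pathSum b (# i) (# j) ≡ k → k ≤ 1 →
                  1 * T [ i , j ] * k ≤ [ wins? b m i j ]· T [ i , j ]
      atMostOne zero          _   _         = ℕ.≤-trans (ℕ.≤-reflexive (ℕ.*-zeroʳ (1 * T [ i , j ]))) z≤n
      atMostOne (suc zero)    one _         = ℕ.≤-reflexive (trans (ℕ.*-identityʳ (1 * T [ i , j ]))
        (trans (ℕ.*-identityˡ _) (sym ([]·-yes (wins? b m i j) (i<j , Fin.toℕ<n j , one)))))
      atMostOne (suc (suc _)) _   (s≤s ())

  -- Restricting to the first y edges only discards transactions, so every column of `P` yields a
  -- bound from below on the revenue of the whole graph.
  W≤feeSum : ∀ {Q : Node m → Node m → Set} (X : ∀ i j → Dec (Q i j)) b y →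
             (∀ i j → pathSum b (# i) (# j) ≡ 1 → Q i j) → W b y ≤ feeSum X b
  W≤feeSum {Q} X b y used = ℕ.≤-trans
    (∑ⁿ-mono (pairs m) λ (i , j) → []·-≤ (wins? b y i j) λ (i<j , _ , one) → ℕ.≤-reflexive (pointwise i j i<j one))
    (ℕ.≤-reflexive (sym (feeSum-pairs X b)))
    where
    indicator-yes : ∀ {P : Set} (d : Dec P) → P → indicator d ≡ 1
    indicator-yes (yes _) p = refl
    indicator-yes (no ¬p) p = contradiction p ¬p
    pointwise : ∀ i j → i Fin.< j → pathSum b (# i) (# j) ≡ 1 → T [ i , j ] ≡
                [ i Fin.<? j ]· (indicator (X i j) * T [ i , j ] * pathSum b (# i) (# j))
    pointwise i j i<j one = sym (trans ([]·-yes (i Fin.<? j) i<j)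
      (trans (cong₂ (λ x s → x * T [ i , j ] * s) (indicator-yes (X i j) (used i j one)) one)
        (trans (ℕ.*-identityʳ (1 * T [ i , j ])) (ℕ.*-identityˡ _))))

  -- Writing `a e` as the sum of its cuts over all K + 1 shifts and exchanging the sums leaves one
  -- rounded revenue per shift, each at most `opt`.
  rounding : ∀ {Q : Node m → Node m → Set} (X : ∀ i j → Dec (Q i j)) a K {opt} → (∀ b → W b m ≤ opt) →
             (∀ i j → Q i j → pathSum a (# i) (# j) ≤ suc K) → feeSum X a ≤ suc K * opt
  rounding X a K {opt} W≤opt short = begin
    feeSum X a
      ≡⟨ ∑ⁿ-cong (nodePairs m) (λ (i , j) → ∑ⁿ-cong (path i j) λ e →
           trans (cong (weight i j *_) (sym (∑ⁿ-cuts a K e)))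
             (sym (∑ⁿ-*ˡ θs (weight i j) (λ θ → cuts a K (toℕ θ) e)))) ⟩
    (∑ⁿ (nodePairs m) λ (i , j) → ∑ⁿ (path i j) λ e → ∑ⁿ θs λ θ → weight i j * cuts a K (toℕ θ) e)
      ≡⟨ ∑ⁿ-cong (nodePairs m) (λ (i , j) → ∑ⁿ-swap (path i j) θs _) ⟩
    (∑ⁿ (nodePairs m) λ (i , j) → ∑ⁿ θs λ θ → ∑ⁿ (path i j) λ e → weight i j * cuts a K (toℕ θ) e)
      ≡⟨ ∑ⁿ-swap (nodePairs m) θs _ ⟩
    ∑ⁿ θs (λ θ → feeSum X (cuts a K (toℕ θ)))
      ≤⟨ ∑ⁿ-mono θs (λ θ → ℕ.≤-trans (feeSum≤W X (cuts a K (toℕ θ)) (λ i j i<j q →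
           pathSum-cuts≤1 a K (toℕ θ) (s≤s z≤n) (s≤s (ℕ.<⇒≤ i<j)) (Fin.toℕ<n j) (short i j q))) (W≤opt _)) ⟩
    ∑ⁿ θs (λ _ → opt)
      ≡⟨ trans (∑ⁿ-const θs opt) (cong (_* opt) (length-tabulate {n = suc K} (λ i → i))) ⟩
    suc K * opt ∎
    where
    open ℕ.≤-Reasoning
    θs = allFin (suc K)
    weight : Node m → Node m → ℕ
    weight i j = indicator (X i j) * T [ i , j ]

-- The recurrence for paying transactions

module _ {m : ℕ} (T : TransactionMatrix (suc m)) where

  Crosses : ℕ → ℕ → ℕ → Node m → Node m → Set
  Crosses i j k u v = i ≤ # u × # u ≤ j × j < # v × # v ≤ k + 1

  crosses? : ∀ i j k u v → Dec (Crosses i j k u v)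
  crosses? i j k u v = (i ≤? # u) ×-dec (# u ≤? j) ×-dec (j <? # v) ×-dec (# v ≤? k + 1)

  -- The intended value of M[i, j, k], extended to all indices.
  crossing : ℕ → ℕ → ℕ → ℕ
  crossing i j k = ∑ⁿ (pairs m) λ (u , v) → [ crosses? i j k u v ]· T [ u , v ]

  module _ {b : Edge m → ℕ} {x : Edge m} {y : ℕ} (beyond : ∀ e → # x < # e → # e ≤ y → b e ≡ 0) where

    private
      ≤1+y : ∀ {v} → v ≤ suc y → v ≤ y + 1
      ≤1+y {v} = subst (v ≤_) (ℕ.+-comm 1 y)

      -- The path has to start at or before x, since b vanishes behind x.
      starts : ∀ {u v : Node m} → Wins T b y u v → # u ≤ # x
      starts {u} {v} (_ , v≤y , one) = ℕ.≮⇒≥ λ x<u → contradiction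
        (trans (sym one) (pathSum-zero {m} {b} (# u) (# v) λ e u≤e e<v →
          beyond e (ℕ.<-≤-trans x<u u≤e) (ℕ.≤-pred (ℕ.<-≤-trans e<v v≤y)))) λ ()

    -- A path that misses x has sum 0 and cannot pay.
    W≤crossing : (∀ e → # e < # x → b e ≡ 0) → W T b y ≤ crossing 1 (# x) y
    W≤crossing before = ∑ⁿ-mono (pairs m) λ (u , v) →
      []·-⇒ (wins? T b y u v) (crosses? 1 (# x) y u v) λ w@(_ , v≤y , one) →
        s≤s z≤n , starts {u} {v} w ,
        ℕ.≰⇒> (λ v≤x → contradiction
          (trans (sym one) (pathSum-zero {m} {b} (# u) (# v) λ e _ e<v → before e (ℕ.<-≤-trans e<v v≤x))) λ ()) ,
        ≤1+y v≤y

    -- A paying path ends at node x or earlier, so it lies on the first x - 1 = `toℕ x` edges, or it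
    -- contains edge x. In the latter case it cannot contain ℓ as well, since its sum would reach 2;
    -- so it starts after ℓ.
    W≤W+crossing : ∀ ℓ → # ℓ < # x → 1 ≤ b ℓ → 1 ≤ b x →
                   W T b y ≤ W T b (toℕ x) + crossing (# ℓ + 1) (# x) y
    W≤W+crossing ℓ ℓ<x 1≤bℓ 1≤bx = ℕ.≤-trans
      (∑ⁿ-mono (pairs m) λ (u , v) →
        []·-cover (wins? T b y u v) (wins? T b (toℕ x) u v) (crosses? (# ℓ + 1) (# x) y u v) (cover u v))
      (ℕ.≤-reflexive (∑ⁿ-+ (pairs m) (λ (u , v) → [ wins? T b (toℕ x) u v ]· T [ u , v ])
        (λ (u , v) → [ crosses? (# ℓ + 1) (# x) y u v ]· T [ u , v ])))
      where
      cover : ∀ u v → Wins T b y u v → Wins T b (toℕ x) u v ⊎ Crosses (# ℓ + 1) (# x) y u v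
      cover u v w@(u<v , v≤y , one) with # v ≤? # x
      ... | yes v≤x = inj₁ (u<v , v≤x , one)
      ... | no  v≰x = inj₂ (subst (_≤ # u) (ℕ.+-comm 1 (# ℓ)) (ℕ.≰⇒> u≰ℓ) , u≤x , x<v , ≤1+y v≤y)
        where
        x<v = ℕ.≰⇒> v≰x
        u≤x = starts {u} {v} w
        u≰ℓ : ¬ (# u ≤ # ℓ)
        u≰ℓ u≤ℓ = contradiction two (ℕ.<⇒≱ (s≤s (s≤s z≤n)))
          where
          two : 2 ≤ 1
          two = begin
            1 + 1
              ≤⟨ ℕ.+-mono-≤ 1≤bℓ 1≤bx ⟩
            b ℓ + b x
              ≤⟨ ℕ.+-mono-≤ (∈path⇒≤pathSum b ℓ u≤ℓ ℓ<x) (∈path⇒≤pathSum b x ℕ.≤-refl x<v) ⟩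
            pathSum b (# u) (# x) + pathSum b (# x) (# v)
              ≡⟨ pathSum-split b u≤x (ℕ.<⇒≤ x<v) ⟨
            pathSum b (# u) (# v)
              ≡⟨ one ⟩
            1 ∎
            where open ℕ.≤-Reasoning

  module _ {b : Edge m → ℕ} {x : Edge m} {y i : ℕ}
           (beyond : ∀ e → # x < # e → b e ≡ 0) (bx≡1 : b x ≡ 1)
           (between : ∀ e → i ≤ # e → # e < # x → b e ≡ 0) where

    private
      crosses⇒wins : ∀ u v → Crosses i (# x) y u v → Wins T b y u v
      crosses⇒wins u v (i≤u , u≤x , x<v , v≤y) =
        ℕ.≤-pred (ℕ.≤-<-trans u≤x x<v) , subst (# v ≤_) (ℕ.+-comm y 1) v≤y , (begin
          pathSum b (# u) (# v)
            ≡⟨ pathSum-split b u≤x (ℕ.<⇒≤ x<v) ⟩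
          pathSum b (# u) (# x) + pathSum b (# x) (# v)
            ≡⟨ cong₂ _+_ (pathSum-zero {m} {b} (# u) (# x) λ e u≤e e<x → between e (ℕ.≤-trans i≤u u≤e) e<x)
                         (pathSum-split b (ℕ.n≤1+n (# x)) x<v) ⟩
          pathSum b (# x) (suc (# x)) + pathSum b (suc (# x)) (# v)
            ≡⟨ cong₂ _+_ (trans (pathSum-edge b x) bx≡1)
                         (pathSum-zero {m} {b} (suc (# x)) (# v) λ e x<e _ → beyond e x<e) ⟩
          1 ∎)
        where open ≡-Reasoning

    crossing≤W : crossing i (# x) y ≤ W T b y
    crossing≤W = ∑ⁿ-mono (pairs m) λ (u , v) →
      []·-⇒ (crosses? i (# x) y u v) (wins? T b y u v) (crosses⇒wins u v)

    -- The two families are disjoint: paths ending by node x, on which `c` and `b` agree, and paths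
    -- through edge x. In the application `c` is the weight of a stored set and `b` that of the set
    -- with x inserted.
    W+crossing≤W : ∀ {c} → (∀ e → # e < # x → c e ≡ b e) → # x ≤ y →
                   W T c (toℕ x) + crossing i (# x) y ≤ W T b y
    W+crossing≤W {c} agree x≤y = ℕ.≤-trans
      (ℕ.≤-reflexive (sym (∑ⁿ-+ (pairs m) (λ (u , v) → [ wins? T c (toℕ x) u v ]· T [ u , v ])
        (λ (u , v) → [ crosses? i (# x) y u v ]· T [ u , v ]))))
      (∑ⁿ-mono (pairs m) λ (u , v) →
        []·-pack (wins? T b y u v) (wins? T c (toℕ x) u v) (crosses? i (# x) y u v)
          (λ (u<v , v≤x , one) → u<v , ℕ.≤-trans v≤x (ℕ.≤-trans x≤y (ℕ.n≤1+n y)) ,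
            trans (pathSum-cong {m} {b} {c} (# u) (# v) λ e _ e<v → sym (agree e (ℕ.<-≤-trans e<v v≤x))) one)
          (crosses⇒wins u v)
          (λ (_ , v≤x , _) (_ , _ , x<v , _) → ℕ.<⇒≱ x<v v≤x))

-- Loops and tables

for-invariant : ∀ {S : Set} (I : S → Set) (xs : List A) {body : A → S → Timed S} →
                (∀ x s → x ∈ xs → I s → I (value (body x s))) →
                ∀ {s} → I s → I (value (for xs s body))
for-invariant I []       step Is = Is
for-invariant I (x ∷ xs) step Is =
  for-invariant I xs (λ y s y∈xs → step y s (there y∈xs)) (step x _ (here refl) Is)

-- For a property `Q` that may fail at first, is established by iteration `z` and survives the
-- others.
for-reaches : ∀ {S : Set} (I Q : S → Set) {xs : List A} {body : A → S → Timed S} →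
              (∀ x s → x ∈ xs → I s → I (value (body x s))) →
              (∀ x s → x ∈ xs → I s → Q s → Q (value (body x s))) →
              ∀ {z} → z ∈ xs → (∀ s → I s → Q (value (body z s))) →
              ∀ {s} → I s → Q (value (for xs s body))
for-reaches I Q {x ∷ xs} step keep (here refl) reach Is = proj₂
  (for-invariant (λ s → I s × Q s) xs
    (λ y s y∈xs (Is , Qs) → step y s (there y∈xs) Is , keep y s (there y∈xs) Is Qs)
    (step x _ (here refl) Is , reach _ Is))
for-reaches I Q {x ∷ xs} step keep (there z∈xs) reach Is =
  for-reaches I Q (λ y s y∈xs → step y s (there y∈xs)) (λ y s y∈xs → keep y s (there y∈xs))
    z∈xs reach (step x _ (here refl) Is)

-- The tail of `tabulate f` is `tabulate (f ∘ Fin.suc)`, so the induction for `allFin` needs a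
-- general `f` that shifts by `c`.
for-tabulate : ∀ {S : Set} {k n} (f : Fin k → Fin n) c → (∀ i → toℕ (f i) ≡ toℕ i + c) →
               (I : ℕ → S → Set) {body : Fin n → S → Timed S} →
               (∀ x s → I (toℕ x) s → I (suc (toℕ x)) (value (body x s))) →
               ∀ {s} → I c s → I (k + c) (value (for (tabulate f) s body))
for-tabulate {k = zero}  f c f≡ I step Is = Is
for-tabulate {k = suc k} f c f≡ I {body} step {s} Is = subst (λ t → I t (value (for (tabulate f) s body))) (ℕ.+-suc k c)
  (for-tabulate (f ∘ Fin.suc) (suc c) (λ i → trans (f≡ (Fin.suc i)) (sym (ℕ.+-suc (toℕ i) c))) I {body} step
    (subst (λ t → I (suc t) (value (body (f Fin.zero) s))) (f≡ Fin.zero)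
      (step (f Fin.zero) s (subst (λ t → I t s) (sym (f≡ Fin.zero)) Is))))

for-allFin : ∀ {S : Set} {n} (I : ℕ → S → Set) {body : Fin n → S → Timed S} →
             (∀ x s → I (toℕ x) s → I (suc (toℕ x)) (value (body x s))) →
             ∀ {s} → I 0 s → I n (value (for (allFin n) s body))
for-allFin {n = n} I {body} step {s} Is = subst (λ t → I t (value (for (allFin n) s body))) (ℕ.+-identityʳ n)
  (for-tabulate id 0 (λ i → sym (ℕ.+-identityʳ (toℕ i))) I {body} step Is)

for-sum : (xs : List A) (g : A → ℕ) {body : A → ℕ → Timed ℕ} →
          (∀ x acc → value (body x acc) ≡ acc + g x) →
          ∀ acc → value (for xs acc body) ≡ acc + ∑ⁿ xs g
for-sum []       g adds acc = sym (ℕ.+-identityʳ acc)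
for-sum (x ∷ xs) g adds acc = trans (for-sum xs g adds _)
  (trans (cong (_+ ∑ⁿ xs g) (adds x acc)) (ℕ.+-assoc acc (g x) _))

≡ᵇ-true : ∀ {a b} → (a ≡ᵇ b) ≡ true → a ≡ b
≡ᵇ-true {a} {b} eq = ℕ.≡ᵇ⇒≡ a b (subst Bool.T (sym eq) tt)

≡ᵇ-refl : ∀ a → (a ≡ᵇ a) ≡ true
≡ᵇ-refl zero    = refl
≡ᵇ-refl (suc a) = ≡ᵇ-refl a

-- The case split concerns the indices alone and each conclusion is polymorphic in the contents, so
-- one split serves `P` and `S` together.
write²-cases : ∀ a b a′ b′ →
  ((a ≡ a′ × b ≡ b′) × (∀ {A} (t : Table² A) v → value (write² t a b v) a′ b′ ≡ v)) ⊎
  (∀ {A} (t : Table² A) v → value (write² t a b v) a′ b′ ≡ t a′ b′)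
write²-cases a b a′ b′ with a ≡ᵇ a′ in eqa | b ≡ᵇ b′ in eqb
... | false | _     = inj₂ λ t v → refl
... | true  | false = inj₂ λ t v → refl
... | true  | true  = inj₁ ((≡ᵇ-true eqa , ≡ᵇ-true eqb) , λ t v → refl)

write²-same : ∀ (t : Table² A) a b v → value (write² t a b v) a b ≡ v
write²-same t a b v rewrite ≡ᵇ-refl a | ≡ᵇ-refl b = refl

write²-other : ∀ (t : Table² A) {a b a′ b′} v → ¬ (a ≡ a′ × b ≡ b′) → value (write² t a b v) a′ b′ ≡ t a′ b′
write²-other t {a} {b} {a′} {b′} v differ with write²-cases a b a′ b′
... | inj₁ (same , _) = contradiction same differ
... | inj₂ kept       = kept t v

write³-cases : ∀ a b c a′ b′ c′ (t : Table³ A) v →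
  ((a ≡ a′ × b ≡ b′ × c ≡ c′) × value (write³ t a b c v) a′ b′ c′ ≡ v) ⊎
  (value (write³ t a b c v) a′ b′ c′ ≡ t a′ b′ c′)
write³-cases a b c a′ b′ c′ t v with a ≡ᵇ a′ in eqa | b ≡ᵇ b′ in eqb | c ≡ᵇ c′ in eqc
... | false | _     | _     = inj₂ refl
... | true  | false | _     = inj₂ refl
... | true  | true  | false = inj₂ refl
... | true  | true  | true  = inj₁ ((≡ᵇ-true eqa , ≡ᵇ-true eqb , ≡ᵇ-true eqc) , refl)

write³-same : ∀ (t : Table³ A) a b c v → value (write³ t a b c v) a b c ≡ v
write³-same t a b c v rewrite ≡ᵇ-refl a | ≡ᵇ-refl b | ≡ᵇ-refl c = refl

∈-from : ∀ {n} {x y : Fin n} → x Fin.≤ y → y ∈ from x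
∈-from {x = x} {y} = ∈-filter⁺ (x Fin.≤?_) (∈-allFin y)

∈-from⁻ : ∀ {n} {x y : Fin n} → y ∈ from x → x Fin.≤ y
∈-from⁻ {n} {x} y∈ = proj₂ (∈-filter⁻ (x Fin.≤?_) {xs = allFin n} y∈)

∈-below : ∀ {n} {x y : Fin n} → y Fin.< x → y ∈ below x
∈-below {x = x} {y} = ∈-filter⁺ (Fin._<? x) (∈-allFin y)

∈-below⁻ : ∀ {n} {x y : Fin n} → y ∈ below x → y Fin.< x
∈-below⁻ {n} {x} y∈ = proj₂ (∈-filter⁻ (Fin._<? x) {xs = allFin n} y∈)

-- The table M

module _ {m : ℕ} (T : TransactionMatrix (suc m)) where

  sumEntries≡crossing : ∀ i j k → value (sumEntries T i j k) ≡ crossing T i j k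
  sumEntries≡crossing i j k = for-sum (pairs m) (λ (u , v) → [ crosses? T i j k u v ]· T [ u , v ])
    -- `does` of `crosses?` computes to the conjunction of the four tests in the loop.
    (λ (u , v) acc → add (does (crosses? T i j k u v)) acc (T [ u , v ])) 0
    where
    add : ∀ c acc t → value (if c then acc +! t else return acc) ≡ acc + (if c then t else 0)
    add true  acc t = refl
    add false acc t = sym (ℕ.+-identityʳ acc)

  private
    M = value (computeM T)

  -- Cells outside i ≤ j ≤ k stay 0, so the inequality holds for all indices and soundness of `P`
  -- can read `M` without range checks.
  computeM-≤ : ∀ a b c → M a b c ≤ crossing T a b c
  computeM-≤ = for-invariant I (allFin m)
    (λ i M _ → for-invariant I (from i) λ j M _ → for-invariant I (from j) λ k M _ → write i j k M)
                 (λ _ _ _ → z≤n)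
    where
    I : Table³ ℕ → Set
    I M = ∀ a b c → M a b c ≤ crossing T a b c
    write : ∀ (i j k : Edge m) M → I M → I (value (write³ M (# i) (# j) (# k) (value (sumEntries T (# i) (# j) (# k)))))
    write i j k M IM a b c with write³-cases (# i) (# j) (# k) a b c M (value (sumEntries T (# i) (# j) (# k)))
    ... | inj₁ ((refl , refl , refl) , eq) = ℕ.≤-reflexive (trans eq (sumEntries≡crossing (# i) (# j) (# k)))
    ... | inj₂ eq = ℕ.≤-trans (ℕ.≤-reflexive eq) (IM a b c)

  -- Every write stores the crossing sum of its own indices, so once the cell is correct any write
  -- preserves this.
  computeM-≡ : ∀ {i j k : Edge m} → i Fin.≤ j → j Fin.≤ k → M (# i) (# j) (# k) ≡ crossing T (# i) (# j) (# k)
  computeM-≡ {i} {j} {k} i≤j j≤k =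
    for-reaches Any Q (λ _ _ _ _ → tt)
      (λ i′ M _ _ → for-invariant Q (from i′) λ j′ M _ → for-invariant Q (from j′) λ k′ M _ → keep i′ j′ k′ M)
      (∈-allFin i)
      (λ M _ → for-reaches Any Q (λ _ _ _ _ → tt)
        (λ j′ M _ _ → for-invariant Q (from j′) λ k′ M _ → keep i j′ k′ M)
        (∈-from i≤j)
        (λ M _ → for-reaches Any Q (λ _ _ _ _ → tt) (λ k′ M _ _ → keep i j k′ M) (∈-from j≤k)
          (λ M _ → trans (write³-same M (# i) (# j) (# k) _) (sumEntries≡crossing (# i) (# j) (# k))) tt) tt) tt
    where
    Any : Table³ ℕ → Set
    Any _ = ⊤
    Q : Table³ ℕ → Set
    Q M = M (# i) (# j) (# k) ≡ crossing T (# i) (# j) (# k)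
    keep : ∀ (i′ j′ k′ : Edge m) M → Q M →
           Q (value (write³ M (# i′) (# j′) (# k′) (value (sumEntries T (# i′) (# j′) (# k′)))))
    keep i′ j′ k′ M QM
      with write³-cases (# i′) (# j′) (# k′) (# i) (# j) (# k) M (value (sumEntries T (# i′) (# j′) (# k′)))
    ... | inj₁ ((i′≡i , j′≡j , k′≡k) , eq) = trans eq (trans (sumEntries≡crossing (# i′) (# j′) (# k′))
      (cong₂ (λ f → f) (cong₂ (crossing T) i′≡i j′≡j) k′≡k))
    ... | inj₂ eq = trans eq QM

-- The tables P and S

weight : ∀ {m} → EdgeSet m → Edge m → ℕ
weight s e = indicator (e ∈? s)

weight-∈ : ∀ {m} (s : EdgeSet m) {e} → e ∈ₛ s → weight s e ≡ 1
weight-∈ s {e} = []·-yes (e ∈? s)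

weight-∉ : ∀ {m} (s : EdgeSet m) {e} → ¬ e ∈ₛ s → weight s e ≡ 0
weight-∉ s {e} = []·-no (e ∈? s)

module _ {m : ℕ} (M : Table³ ℕ) where

  -- Labels start at 1, so column x - 1 is `toℕ x`.
  candidate : Table² ℕ → Edge m → Edge m → Edge m → ℕ
  candidate P x y ℓ = P (# ℓ) (toℕ x) + M (# ℓ + 1) (# x) (# y)

  tryPrevious-cases : ∀ x y ℓ (P : Table² ℕ) (S : Table² (EdgeSet m)) →
    (candidate P x y ℓ ≤ P (# x) (# y) × value (tryPrevious M x y ℓ (P , S)) ≡ (P , S)) ⊎
    (P (# x) (# y) < candidate P x y ℓ × value (tryPrevious M x y ℓ (P , S)) ≡
      (value (write² P (# x) (# y) (candidate P x y ℓ)) , value (write² S (# x) (# y) (⁅ x ⁆ ∪ S (# ℓ) (toℕ x)))))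
  tryPrevious-cases x y ℓ P S with P (# x) (# y) <ᵇ candidate P x y ℓ in eq
  ... | true  = inj₂ (ℕ.<ᵇ⇒< _ _ (subst Bool.T (sym eq) tt) , refl)
  ... | false = inj₁ (ℕ.≮⇒≥ (λ lt → subst Bool.T eq (ℕ.<⇒<ᵇ lt)) , refl)

  -- The loop body of `computePS`, named so that single cells can be discussed.
  fillCell : Edge m → Edge m → Tables m → Timed (Tables m)
  fillCell x y (P , S) = do
    P′ ← write² P (# x) (# y) (M 1 (# x) (# y))
    s  ← singleton! x
    S′ ← write² S (# x) (# y) s
    for (below x) (P′ , S′) (tryPrevious M x y)

  -- The two tables are rewritten in step, so an invariant of all cells only
  -- has to be checked for the pair of values that is written.
  writeBoth : (I : ℕ → ℕ → ℕ → EdgeSet m → Set) (x y : Edge m) (P : Table² ℕ) (S : Table² (EdgeSet m)) →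
              ∀ v s → I (# x) (# y) v s → (∀ a c → I a c (P a c) (S a c)) →
              ∀ a c → I a c (value (write² P (# x) (# y) v) a c) (value (write² S (# x) (# y) s) a c)
  writeBoth I x y P S v s Ivs IPS a c with write²-cases (# x) (# y) a c
  ... | inj₁ ((refl , refl) , written) = subst₂ (I a c) (sym (written P v)) (sym (written S s)) Ivs
  ... | inj₂ kept = subst₂ (I a c) (sym (kept P v)) (sym (kept S s)) (IPS a c)

  fillCell-frame : ∀ x y P S {a c} → ¬ (# x ≡ a × # y ≡ c) → proj₁ (value (fillCell x y (P , S))) a c ≡ P a c
  fillCell-frame x y P S {a} {c} differ =
    for-invariant (λ PS → proj₁ PS a c ≡ P a c) (below x)
      (λ ℓ (P′ , S′) _ → keep ℓ P′ S′) (write²-other P _ differ)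
    where
    keep : ∀ ℓ P′ S′ → P′ a c ≡ P a c → proj₁ (value (tryPrevious M x y ℓ (P′ , S′))) a c ≡ P a c
    keep ℓ P′ S′ same with tryPrevious-cases x y ℓ P′ S′
    ... | inj₁ (_ , eq) = trans (cong (λ PS → proj₁ PS a c) eq) same
    ... | inj₂ (_ , eq) = trans (cong (λ PS → proj₁ PS a c) eq) (trans (write²-other P′ _ differ) same)

  -- Only one direction of the recurrence; the other bound on `P` is supplied by `Sound`.
  Settled : Table² ℕ → Edge m → Edge m → Set
  Settled P x y = M 1 (# x) (# y) ≤ P (# x) (# y) × (∀ ℓ → ℓ Fin.< x → candidate P x y ℓ ≤ P (# x) (# y))

  -- Cell (x, y) never decreases while the predecessors are tried, and the cells (ℓ, x - 1) read by
  -- the candidates lie in earlier rows, which are not written. So each candidate still has its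
  -- value at the end.
  fillCell-settles : ∀ x y PS → Settled (proj₁ (value (fillCell x y PS))) x y
  fillCell-settles x y (P , S) =
    for-invariant AboveBase (below x)
      (λ ℓ (P , S) _ base → ℕ.≤-trans base (increases ℓ P S))
      (ℕ.≤-reflexive (sym (write²-same P (# x) (# y) _))) ,
    λ ℓ ℓ<x → for-reaches (λ _ → ⊤) (Above ℓ) (λ _ _ _ _ → tt)
      (λ ℓ′ (P , S) ℓ′∈ _ Q → ℕ.≤-trans (ℕ.≤-reflexive (cong (_+ M (# ℓ + 1) (# x) (# y)) (previous ℓ<x ℓ′ P S)))
        (ℕ.≤-trans Q (increases ℓ′ P S)))
      (∈-below ℓ<x)
      (λ (P , S) _ → ℕ.≤-trans (ℕ.≤-reflexive (cong (_+ M (# ℓ + 1) (# x) (# y)) (previous ℓ<x ℓ P S)))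
        (reaches ℓ P S))
      tt
    where
    AboveBase : Tables m → Set
    AboveBase (P , _) = M 1 (# x) (# y) ≤ P (# x) (# y)
    Above : Edge m → Tables m → Set
    Above ℓ (P , _) = candidate P x y ℓ ≤ P (# x) (# y)
    after : ∀ ℓ P S → Table² ℕ
    after ℓ P S = proj₁ (value (tryPrevious M x y ℓ (P , S)))
    increases : ∀ ℓ P S → P (# x) (# y) ≤ after ℓ P S (# x) (# y)
    increases ℓ P S with tryPrevious-cases x y ℓ P S
    ... | inj₁ (_ , eq) = ℕ.≤-reflexive (cong (λ PS → proj₁ PS (# x) (# y)) (sym eq))
    ... | inj₂ (lt , eq) = ℕ.≤-trans (ℕ.<⇒≤ lt) (ℕ.≤-reflexive
      (sym (trans (cong (λ PS → proj₁ PS (# x) (# y)) eq) (write²-same P (# x) (# y) _))))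
    reaches : ∀ ℓ P S → candidate P x y ℓ ≤ after ℓ P S (# x) (# y)
    reaches ℓ P S with tryPrevious-cases x y ℓ P S
    ... | inj₁ (le , eq) = ℕ.≤-trans le (ℕ.≤-reflexive (cong (λ PS → proj₁ PS (# x) (# y)) (sym eq)))
    ... | inj₂ (_ , eq) = ℕ.≤-reflexive
      (sym (trans (cong (λ PS → proj₁ PS (# x) (# y)) eq) (write²-same P (# x) (# y) _)))
    previous : ∀ {ℓ} → ℓ Fin.< x → ∀ ℓ′ P S → after ℓ′ P S (# ℓ) (toℕ x) ≡ P (# ℓ) (toℕ x)
    previous ℓ<x ℓ′ P S with tryPrevious-cases x y ℓ′ P S
    ... | inj₁ (_ , eq) = cong (λ PS → proj₁ PS _ _) eq
    ... | inj₂ (_ , eq) = trans (cong (λ PS → proj₁ PS _ _) eq)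
      (write²-other P {# x} {# y} _ λ (x≡ℓ , _) → ℕ.<⇒≢ (s≤s ℓ<x) (sym x≡ℓ))

  -- The hypothesis covers all rows before x and, in row x, the cell (x, y) alone: everything that
  -- `Settled P x y` reads.
  Settled-cong : ∀ {P P′ : Table² ℕ} {x y} → (∀ a c → a ≤ # x → (a ≡ # x → c ≡ # y) → P′ a c ≡ P a c) →
                 Settled P x y → Settled P′ x y
  Settled-cong {P} {P′} {x} {y} same (base , step) =
    subst (M 1 (# x) (# y) ≤_) (sym samexy) base ,
    λ ℓ ℓ<x → subst₂ _≤_
      (cong (_+ M (# ℓ + 1) (# x) (# y))
        (sym (same (# ℓ) (toℕ x) (ℕ.<⇒≤ (s≤s ℓ<x)) λ ℓ≡x → contradiction ℓ≡x (ℕ.<⇒≢ (s≤s ℓ<x)))))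
      (sym samexy) (step ℓ ℓ<x)
    where
    samexy : P′ (# x) (# y) ≡ P (# x) (# y)
    samexy = same (# x) (# y) ℕ.≤-refl λ _ → refl

  computePS-settles : ∀ {x y : Edge m} → x Fin.≤ y → Settled (proj₁ (value (computePS {m} M))) x y
  computePS-settles {x} {y} x≤y = for-allFin I outer {(λ _ _ → 0) , (λ _ _ → ⊥)} (λ _ _ ()) x y (Fin.toℕ<n x) x≤y
    where
    I : ℕ → Tables m → Set
    I t (P , _) = ∀ x y → toℕ x < t → x Fin.≤ y → Settled P x y
    row : Edge m → Tables m → Tables m
    row x PS = value (for (from x) PS (fillCell x))
    row-frame : ∀ x PS {a c} → # x ≢ a → proj₁ (row x PS) a c ≡ proj₁ PS a c
    row-frame x PS {a} {c} x≢a = for-invariant (λ PS′ → proj₁ PS′ a c ≡ proj₁ PS a c) (from x)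
      (λ y (P , S) _ same → trans (fillCell-frame x y P S (x≢a ∘ proj₁)) same) refl
    row-settles : ∀ x PS y → x Fin.≤ y → Settled (proj₁ (row x PS)) x y
    row-settles x PS y x≤y = for-reaches (λ _ → ⊤) (λ PS → Settled (proj₁ PS) x y) (λ _ _ _ _ → tt)
      (λ y′ PS _ _ → keep y′ PS (y′ Fin.≟ y)) (∈-from x≤y) (λ PS _ → fillCell-settles x y PS) tt
      where
      keep : ∀ y′ PS → Dec (y′ ≡ y) → Settled (proj₁ PS) x y → Settled (proj₁ (value (fillCell x y′ PS))) x y
      keep y′ PS (yes refl) _ = fillCell-settles x y PS
      keep y′ (P , S) (no y′≢y) = Settled-cong {P} {proj₁ (value (fillCell x y′ (P , S)))}
        λ a c _ a≡x⇒c≡y → fillCell-frame x y′ P S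
        λ (x≡a , y′≡c) → y′≢y (Fin.toℕ-injective (ℕ.suc-injective (trans y′≡c (a≡x⇒c≡y (sym x≡a)))))
    outer : ∀ x PS → I (toℕ x) PS → I (suc (toℕ x)) (row x PS)
    outer x PS IPS x′ y′ x′<x+1 x′≤y′ with x′ Fin.≟ x
    ... | yes refl = row-settles x PS y′ x′≤y′
    ... | no x′≢x  = Settled-cong {proj₁ PS} {proj₁ (row x PS)} (λ a c a≤x′ _ → row-frame x PS {a} {c} λ x≡a →
        ℕ.<⇒≱ x′<x (ℕ.≤-pred (subst (_≤ # x′) (sym x≡a) a≤x′))) (IPS x′ y′ x′<x x′≤y′)
      where
      x′<x : toℕ x′ < toℕ x
      x′<x = ℕ.≤∧≢⇒< (ℕ.≤-pred x′<x+1) (x′≢x ∘ Fin.toℕ-injective)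

  module _ (T : TransactionMatrix (suc m)) (M≤crossing : ∀ a b c → M a b c ≤ crossing T a b c) where

    -- The second component makes insertion possible: a set stored in row ℓ has no edge after ℓ, so
    -- all paths counted by M[ℓ+1, x, y] meet the enlarged set in x only.
    SoundCell : ℕ → ℕ → ℕ → EdgeSet m → Set
    SoundCell a c v s = v ≤ W T (weight s) c × (∀ e → e ∈ₛ s → # e ≤ a)

    Sound : Tables m → Set
    Sound (P , S) = ∀ a c → SoundCell a c (P a c) (S a c)

    sound-single : ∀ (x y : Edge m) → SoundCell (# x) (# y) (M 1 (# x) (# y)) ⁅ x ⁆
    sound-single x y =
      ℕ.≤-trans (M≤crossing 1 (# x) (# y)) (crossing≤W T {weight ⁅ x ⁆} {x} {# y} {1}
        (λ e x<e → weight-∉ ⁅ x ⁆ λ e∈ → ℕ.<⇒≢ x<e (cong #_ (sym (x∈⁅y⁆⇒x≡y x e∈))))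
        (weight-∈ ⁅ x ⁆ (x∈⁅x⁆ x))
        (λ e _ e<x → weight-∉ ⁅ x ⁆ λ e∈ → ℕ.<⇒≢ e<x (cong #_ (x∈⁅y⁆⇒x≡y x e∈)))) ,
      λ e e∈ → ℕ.≤-reflexive (cong #_ (x∈⁅y⁆⇒x≡y x e∈))

    sound-insert : ∀ (x y ℓ : Edge m) v s → ℓ Fin.< x → x Fin.≤ y → SoundCell (# ℓ) (toℕ x) v s →
                   SoundCell (# x) (# y) (v + M (# ℓ + 1) (# x) (# y)) (⁅ x ⁆ ∪ s)
    sound-insert x y ℓ v s ℓ<x x≤y (v≤W , s≤ℓ) =
      ℕ.≤-trans (ℕ.+-mono-≤ v≤W (M≤crossing (# ℓ + 1) (# x) (# y)))
        (W+crossing≤W T {weight (⁅ x ⁆ ∪ s)} {x}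
          (λ e x<e → weight-∉ (⁅ x ⁆ ∪ s) λ e∈ → ℕ.<⇒≱ x<e (≤x e e∈))
          (weight-∈ (⁅ x ⁆ ∪ s) (p⊆p∪q s (x∈⁅x⁆ x)))
          (λ e ℓ<e e<x → weight-∉ (⁅ x ⁆ ∪ s) λ e∈ →
            ℕ.<⇒≱ (subst (_≤ # e) (ℕ.+-comm (# ℓ) 1) ℓ<e) (s≤ℓ e (∈s e e<x e∈)))
          (λ e e<x → agree e e<x (e ∈? s))
          (s≤s x≤y)) , ≤x
      where
      ∈s : ∀ e → # e < # x → e ∈ₛ ⁅ x ⁆ ∪ s → e ∈ₛ s
      ∈s e e<x e∈ with x∈p∪q⁻ ⁅ x ⁆ s e∈
      ... | inj₁ e∈x = contradiction (cong #_ (x∈⁅y⁆⇒x≡y x e∈x)) (ℕ.<⇒≢ e<x)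
      ... | inj₂ e∈s = e∈s
      ≤x : ∀ e → e ∈ₛ ⁅ x ⁆ ∪ s → # e ≤ # x
      ≤x e e∈ with x∈p∪q⁻ ⁅ x ⁆ s e∈
      ... | inj₁ e∈x = ℕ.≤-reflexive (cong #_ (x∈⁅y⁆⇒x≡y x e∈x))
      ... | inj₂ e∈s = ℕ.≤-trans (s≤ℓ e e∈s) (ℕ.<⇒≤ (s≤s ℓ<x))
      agree : ∀ e → # e < # x → Dec (e ∈ₛ s) → weight s e ≡ weight (⁅ x ⁆ ∪ s) e
      agree e e<x (yes e∈s) = trans (weight-∈ s e∈s) (sym (weight-∈ (⁅ x ⁆ ∪ s) (q⊆p∪q ⁅ x ⁆ s e∈s)))
      agree e e<x (no e∉s)  = trans (weight-∉ s e∉s) (sym (weight-∉ (⁅ x ⁆ ∪ s) (e∉s ∘ ∈s e e<x)))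

    computePS-sound : Sound (value (computePS {m} M))
    computePS-sound = for-invariant Sound (allFin m)
      (λ x PS _ → for-invariant Sound (from x) λ y (P , S) y∈ sound →
        for-invariant Sound (below x)
          (λ ℓ (P , S) ℓ∈ → attempt x y ℓ P S (∈-below⁻ ℓ∈) (∈-from⁻ y∈))
          (writeBoth SoundCell x y P S _ _ (sound-single x y) sound))
      λ _ _ → z≤n , λ e e∈ → contradiction e∈ ∉⊥
      where
      attempt : ∀ x y ℓ P S → ℓ Fin.< x → x Fin.≤ y → Sound (P , S) → Sound (value (tryPrevious M x y ℓ (P , S)))
      attempt x y ℓ P S ℓ<x x≤y sound with tryPrevious-cases x y ℓ P S
      ... | inj₁ (_ , eq) = subst Sound (sym eq) sound
      ... | inj₂ (_ , eq) = subst Sound (sym eq) (writeBoth SoundCell x y P S _ _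
        (sound-insert x y ℓ (P (# ℓ) (toℕ x)) (S (# ℓ) (toℕ x)) ℓ<x x≤y (sound (# ℓ) (toℕ x))) sound)

-- Selection of the maximum

Attained : ∀ {m} → Table² ℕ → ℕ → Maybe (Edge m × Edge m) → Set
Attained P v best = ∃[ x ] ∃[ y ] best ≡ just (x , y) × v ≤ P (# x) (# y)

-- The value of the best pair never decreases, since a tie exchanges pairs of equal value, and it is
-- at least that of (x, y) once this pair has been visited.
selectMax-max : ∀ {m} (tie : TieRule m) P {x y} → x Fin.≤ y → Attained P (P (# x) (# y)) (value (selectMax tie P))
selectMax-max {m} tie P {x} {y} x≤y =
  for-reaches (λ _ → ⊤) Q (λ _ _ _ _ → tt)
    (λ x′ best _ _ → for-invariant Q (from x′) λ { y′ nothing _ → λ () ; y′ (just _) _ → keep x′ y′ _ })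
    (∈-allFin x)
    (λ best _ → for-reaches (λ _ → ⊤) Q (λ _ _ _ _ → tt)
      (λ { y′ nothing _ _ → λ () ; y′ (just _) _ _ → keep x y′ _ })
      (∈-from x≤y) (λ { nothing _ → x , y , refl , ℕ.≤-refl ; (just best) _ → reach best }) tt)
    tt
  where
  Q : Maybe (Edge m × Edge m) → Set
  Q = Attained P (P (# x) (# y))
  better : Edge m × Edge m → Edge m × Edge m → Bool
  better cur@(x , y) best@(x′ , y′) =
    (P (# x′) (# y′) <ᵇ P (# x) (# y)) ∨ ((P (# x′) (# y′) ≡ᵇ P (# x) (# y)) ∧ tie cur best)
  better-true : ∀ p q t → ((p <ᵇ q) ∨ ((p ≡ᵇ q) ∧ t)) ≡ true → p ≤ q
  better-true p q t eq with p <ᵇ q in lt | p ≡ᵇ q in e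
  ... | true  | _    = ℕ.<⇒≤ (ℕ.<ᵇ⇒< p q (subst Bool.T (sym lt) tt))
  ... | false | true = ℕ.≤-reflexive (≡ᵇ-true e)
  better-false : ∀ p q t → ((p <ᵇ q) ∨ ((p ≡ᵇ q) ∧ t)) ≡ false → q ≤ p
  better-false p q t eq with p <ᵇ q in lt
  ... | false = ℕ.≮⇒≥ λ p<q → subst Bool.T lt (ℕ.<⇒<ᵇ p<q)
  update : Edge m × Edge m → Edge m × Edge m → Maybe (Edge m × Edge m)
  update cur best = just (if better cur best then cur else best)
  keep : ∀ x′ y′ best → Q (just best) → Q (update (x′ , y′) best)
  keep x′ y′ best (_ , _ , refl , le) with better (x′ , y′) best in eq
  ... | true  = x′ , y′ , refl , ℕ.≤-trans le (better-true _ _ _ eq)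
  ... | false = _ , _ , refl , le
  reach : ∀ best → Q (update (x , y) best)
  reach best with better (x , y) best in eq
  ... | true  = x , y , refl , ℕ.≤-refl
  ... | false = _ , _ , refl , better-false _ _ _ eq

-- The recurrence bounds every weighting

module _ {m : ℕ} (T : TransactionMatrix (suc m)) (P : Table² ℕ)
         (base : ∀ (x : Edge m) y → # x ≤ y → y ≤ m → crossing T 1 (# x) y ≤ P (# x) y)
         (step : ∀ (x : Edge m) y → # x ≤ y → y ≤ m → ∀ (ℓ : Edge m) → # ℓ < # x →
                 P (# ℓ) (toℕ x) + crossing T (# ℓ + 1) (# x) y ≤ P (# x) y) where

  -- When it exists, ℓ is the last edge of positive weight among the first t.
  Dominated : (Edge m → ℕ) → ℕ → Set
  Dominated b t = ∀ y → t ≤ y → y ≤ m → (∀ e → t < # e → # e ≤ y → b e ≡ 0) →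
    (∀ e → # e ≤ t → b e ≡ 0) ⊎ (Σ[ ℓ ∈ Edge m ] # ℓ ≤ t × 1 ≤ b ℓ × W T b y ≤ P (# ℓ) y)

  -- Induction on the prefix length with `y` left general: an edge of weight zero passes to the
  -- shorter prefix with the same `y`, an edge of positive weight with `y` cut back.
  dominated : ∀ b t → t ≤ m → Dominated b t
  dominated b zero    _   y _ _ _ = inj₁ λ _ ()
  dominated b (suc t) t<m with edge-at (suc t) (s≤s z≤n) t<m
  ... | x , #x≡t = subst (Dominated b) #x≡t
    (extend x (subst (Dominated b) (sym (ℕ.suc-injective #x≡t)) (dominated b t (ℕ.<⇒≤ t<m))))
    where
    extend : ∀ x → Dominated b (toℕ x) → Dominated b (# x)
    extend x IH y x≤y y≤m beyond = byWeight (b x) refl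
      where
      byWeight : ∀ k → b x ≡ k →
        (∀ e → # e ≤ # x → b e ≡ 0) ⊎ (Σ[ ℓ ∈ Edge m ] # ℓ ≤ # x × 1 ≤ b ℓ × W T b y ≤ P (# ℓ) y)
      byWeight zero bx≡0 with IH y (ℕ.<⇒≤ x≤y) y≤m at-or-beyond
        where
        at-or-beyond : ∀ e → toℕ x < # e → # e ≤ y → b e ≡ 0
        at-or-beyond e x≤e e≤y with x Fin.≟ e
        ... | yes refl = bx≡0
        ... | no x≢e   = beyond e (ℕ.≤∧≢⇒< x≤e (x≢e ∘ Fin.toℕ-injective ∘ ℕ.suc-injective)) e≤y
      ... | inj₂ (ℓ , ℓ≤x , 1≤bℓ , W≤P) = inj₂ (ℓ , ℕ.≤-trans ℓ≤x (ℕ.n≤1+n _) , 1≤bℓ , W≤P)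
      ... | inj₁ zeros = inj₁ before
        where
        before : ∀ e → # e ≤ # x → b e ≡ 0
        before e e≤x with e Fin.≟ x
        ... | yes refl = bx≡0
        ... | no e≢x   = zeros e (ℕ.≤-pred (ℕ.≤∧≢⇒< e≤x (e≢x ∘ Fin.toℕ-injective ∘ ℕ.suc-injective)))
      -- x is the last positive edge, and the recurrence refers to column x - 1, where no edge lies
      -- beyond the shorter prefix.
      byWeight (suc k) bx≡ with IH (toℕ x) ℕ.≤-refl (ℕ.≤-trans (ℕ.n≤1+n _) (ℕ.≤-trans x≤y y≤m))
                                   (λ e x<e e≤x → contradiction e≤x (ℕ.<⇒≱ x<e))
      ... | inj₁ zeros = inj₂ (x , ℕ.≤-refl , 1≤bx , ℕ.≤-trans
        (W≤crossing T beyond λ e e<x → zeros e (ℕ.≤-pred e<x)) (base x y x≤y y≤m))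
        where 1≤bx = subst (1 ≤_) (sym bx≡) (s≤s z≤n)
      ... | inj₂ (ℓ , ℓ≤x , 1≤bℓ , W≤P) = inj₂ (x , ℕ.≤-refl , 1≤bx , ℕ.≤-trans
        (W≤W+crossing T beyond ℓ (s≤s ℓ≤x) 1≤bℓ 1≤bx)
        (ℕ.≤-trans (ℕ.+-monoˡ-≤ _ W≤P) (step x y x≤y y≤m ℓ (s≤s ℓ≤x))))
        where 1≤bx = subst (1 ≤_) (sym bx≡) (s≤s z≤n)

  W≤max : ∀ {opt} → 1 ≤ m → (∀ x → P (# x) m ≤ opt) → ∀ b → W T b m ≤ opt
  W≤max 1≤m P≤opt b with dominated b m ℕ.≤-refl m ℕ.≤-refl ℕ.≤-refl (λ e m<e e≤m → contradiction e≤m (ℕ.<⇒≱ m<e))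
  ... | inj₂ (ℓ , _ , _ , W≤P) = ℕ.≤-trans W≤P (P≤opt ℓ)
  -- With all weights zero no path pays; edge 1 serves as a dummy last edge.
  ... | inj₁ zeros with x , _ ← edge-at 1 ℕ.≤-refl 1≤m = ℕ.≤-trans
    (W≤crossing T {x = x} (λ e _ → zeros e) (λ e _ → zeros e (Fin.toℕ<n e)))
    (ℕ.≤-trans (base x m (Fin.toℕ<n x) ℕ.≤-refl) (P≤opt x))

-- Running time

length-cartesianProduct : ∀ (xs : List A) (ys : List B) → length (cartesianProduct xs ys) ≡ length xs * length ys
length-cartesianProduct []       ys = refl
length-cartesianProduct (x ∷ xs) ys = trans (length-++ (map (x ,_) ys))
  (cong₂ _+_ (length-map (x ,_) ys) (length-cartesianProduct xs ys))

for-time : ∀ {S : Set} (xs : List A) {body : A → S → Timed S} {t} → (∀ x s → time (body x s) ≤ t) →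
           ∀ s → time (for xs s body) ≤ length xs * suc t
for-time []       body≤t s = z≤n
for-time (x ∷ xs) {body} {t} body≤t s = begin
  1 + (time (body x s) + time (for xs (value (body x s)) body)) ≤⟨ s≤s (ℕ.+-mono-≤ (body≤t x s) (for-time xs body≤t _)) ⟩
  suc t + length xs * suc t                                     ∎
  where open ℕ.≤-Reasoning

module _ (m : ℕ) where

  private
    n = suc m

  c≤c*n^ : ∀ c k → c ≤ c * n ^ k
  c≤c*n^ c k = ℕ.≤-trans (ℕ.≤-reflexive (sym (ℕ.*-identityʳ c))) (ℕ.*-monoʳ-≤ c (ℕ.m^n>0 n k))

  *n^-mono : ∀ c {j k} → j ≤ k → c * n ^ j ≤ c * n ^ k
  *n^-mono c j≤k = ℕ.*-monoʳ-≤ c (ℕ.^-monoʳ-≤ n j≤k)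

  m≤n^ : ∀ k → m ≤ 1 * n ^ suc k
  m≤n^ k = ℕ.≤-trans (ℕ.n≤1+n m) (ℕ.≤-trans
    (ℕ.≤-reflexive (sym (trans (ℕ.*-identityˡ (n ^ 1)) (ℕ.*-identityʳ n))))
    (*n^-mono 1 (s≤s (z≤n {k}))))

  +-*n^ : ∀ {a b} c d k → a ≤ c * n ^ k → b ≤ d * n ^ k → a + b ≤ (c + d) * n ^ k
  +-*n^ c d k a≤ b≤ = ℕ.≤-trans (ℕ.+-mono-≤ a≤ b≤) (ℕ.≤-reflexive (sym (ℕ.*-distribʳ-+ (n ^ k) c d)))

  -- The unit charged per iteration is absorbed as n ^ k ≥ 1, so each loop adds one to the
  -- coefficient and to the exponent.
  for-time-^ : ∀ {S : Set} (xs : List A) {body : A → S → Timed S} c k → length xs ≤ n →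
               (∀ x s → time (body x s) ≤ c * n ^ k) → ∀ s → time (for xs s body) ≤ suc c * n ^ suc k
  for-time-^ xs {body} c k xs≤n body≤ s = begin
    time (for xs s body)          ≤⟨ for-time xs body≤ s ⟩
    length xs * suc (c * n ^ k)   ≤⟨ ℕ.*-mono-≤ xs≤n (ℕ.+-monoˡ-≤ (c * n ^ k) (ℕ.m^n>0 n k)) ⟩
    n * (suc c * n ^ k)           ≡⟨ ℕ.*-assoc n (suc c) (n ^ k) ⟨
    n * suc c * n ^ k             ≡⟨ cong (_* n ^ k) (ℕ.*-comm n (suc c)) ⟩
    suc c * n * n ^ k             ≡⟨ ℕ.*-assoc (suc c) n (n ^ k) ⟩
    suc c * n ^ suc k             ∎
    where open ℕ.≤-Reasoning

  allFin≤n : length (allFin m) ≤ n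
  allFin≤n = ℕ.≤-trans (ℕ.≤-reflexive (length-tabulate id)) (ℕ.n≤1+n m)

  from≤n : ∀ x → length (from {m} x) ≤ n
  from≤n x = ℕ.≤-trans (length-filter (x Fin.≤?_) (allFin m)) allFin≤n

  below≤n : ∀ x → length (below {m} x) ≤ n
  below≤n x = ℕ.≤-trans (length-filter (Fin._<? x) (allFin m)) allFin≤n

  -- Per entry: four comparisons, the sum k + 1, at most one addition to the accumulator and the
  -- loop charge.
  sumEntries-time : ∀ T i j k → time (sumEntries {m} T i j k) ≤ 7 * n ^ 2
  sumEntries-time T i j k = begin
    time (sumEntries {m} T i j k)
      ≤⟨ for-time (pairs m) (λ (u , v) acc → ℕ.+-monoʳ-≤ 5 (add≤1 (does (crosses? T i j k u v)) acc (T [ u , v ]))) 0 ⟩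
    length (pairs m) * 7
      ≡⟨ cong (_* 7) (trans (length-cartesianProduct (allFin n) (allFin n))
           (cong₂ _*_ (length-tabulate {n = n} id) (length-tabulate {n = n} id))) ⟩
    n * n * 7
      ≡⟨ ℕ.*-comm (n * n) 7 ⟩
    7 * (n * n)
      ≡⟨ cong (λ p → 7 * (n * p)) (ℕ.*-identityʳ n) ⟨
    7 * n ^ 2 ∎
    where
    open ℕ.≤-Reasoning
    add≤1 : ∀ c acc t → time (if c then acc +! t else return acc) ≤ 1
    add≤1 true  acc t = ℕ.≤-refl
    add≤1 false acc t = z≤n

  computeM-time : ∀ T → time (computeM {m} T) ≤ 11 * n ^ 5
  computeM-time T =
    for-time-^ (allFin m) 10 4 allFin≤n (λ i M →
    for-time-^ (from i) 9 3 (from≤n i) (λ j M →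
    for-time-^ (from j) 8 2 (from≤n j) (λ k M →
      +-*n^ 7 1 2 (sumEntries-time T (# i) (# j) (# k)) (c≤c*n^ 1 2)) M) M) _

  tryPrevious-time : ∀ M x y ℓ PS → time (tryPrevious {m} M x y ℓ PS) ≤ 7 * n ^ 1
  -- Four operations before the branch, then at most two writes and m for the edge set: 6 + m ≤ 7n.
  tryPrevious-time M x y ℓ (P , S) = ℕ.≤-trans (ℕ.+-monoʳ-≤ 4 (update≤ (P (# x) (# y) <ᵇ candidate M P x y ℓ)))
    (+-*n^ 6 1 1 (c≤c*n^ 6 1) (m≤n^ 0))
    where
    update≤ : ∀ better → time (if better
        then (do
          P′ ← write² P (# x) (# y) (candidate M P x y ℓ)
          s  ← insert! x (S (# ℓ) (toℕ x))
          S′ ← write² S (# x) (# y) s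
          return (P′ , S′))
        else return (P , S)) ≤ 2 + m
    update≤ true  = s≤s (ℕ.≤-reflexive (ℕ.+-comm m 1))
    update≤ false = z≤n

  computePS-time : ∀ M → time (computePS {m} M) ≤ 13 * n ^ 4
  computePS-time M =
    for-time-^ (allFin m) 12 3 allFin≤n (λ x PS →
    for-time-^ (from x) 11 2 (from≤n x) (λ y PS →
      +-*n^ 1 10 2 (c≤c*n^ 1 2) (+-*n^ 1 9 2 (m≤n^ 1) (+-*n^ 1 8 2 (c≤c*n^ 1 2)
        (for-time-^ (below x) 7 1 (below≤n x) (tryPrevious-time M x y) _)))) PS) _

  selectMax-time : ∀ tie P → time (selectMax {m} tie P) ≤ 4 * n ^ 2
  selectMax-time tie P =
    for-time-^ (allFin m) 3 1 allFin≤n (λ x best →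
    for-time-^ (from x) 2 0 (from≤n x) (λ { y nothing → z≤n ; y (just _) → ℕ.≤-refl }) best) _

  output!-time : ∀ PS best → time (output! {m} PS best) ≤ 1 * n ^ 1
  output!-time PS (just _) = ℕ.≤-trans (ℕ.≤-reflexive (ℕ.+-identityʳ m)) (m≤n^ 0)
  output!-time PS nothing  = ℕ.≤-trans (ℕ.≤-reflexive (ℕ.+-identityʳ m)) (m≤n^ 0)

  dynamicProgram-time : ∀ tie T → time (dynamicProgram {m} tie T) ≤ 29 * n ^ 5
  -- 29 = 11 + 13 + 4 + 1, one summand per phase; the last three phases have bounds of lower degree,
  -- raised to n ^ 5.
  dynamicProgram-time tie T = +-*n^ 11 18 5 (computeM-time T)
    (+-*n^ 13 5 5 (ℕ.≤-trans (computePS-time M) (*n^-mono 13 {4} {5} (ℕ.n≤1+n 4)))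
      (+-*n^ 4 1 5 (ℕ.≤-trans (selectMax-time tie P) (*n^-mono 4 {2} {5} (s≤s (s≤s z≤n))))
        (ℕ.≤-trans (output!-time PS best) (*n^-mono 1 {1} {5} (s≤s z≤n)))))
    where
    M = value (computeM T)
    PS = value (computePS {m} M)
    P = proj₁ PS
    best = value (selectMax tie P)

-- Optimality

module _ {m : ℕ} (T : TransactionMatrix (suc m)) where

  -- The part of `profit` that is added to -m.
  feeTotal : (f : FeeAssignment m) → Usage f → ℝ
  feeTotal f X = ∑ (nodePairs m) λ (i , j) → ∑ (path i j) λ e → (indicator (X i j) * T [ i , j ]) · f e

  feeSum-+ : ∀ {Q : Node m → Node m → Set} (X : ∀ i j → Dec (Q i j)) b c →
             feeSum T X (λ e → b e + c e) ≡ feeSum T X b + feeSum T X c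
  feeSum-+ X b c = trans
    (∑ⁿ-cong (nodePairs m) λ (i , j) → let w = indicator (X i j) * T [ i , j ] in
      trans (∑ⁿ-cong (path i j) λ e → ℕ.*-distribˡ-+ w (b e) (c e))
        (∑ⁿ-+ (path i j) (λ e → w * b e) (λ e → w * c e)))
    (∑ⁿ-+ (nodePairs m) _ _)

  module _ {f : FeeAssignment m} (X : Usage f) {K : ℕ} where

    feeTotal-Upper : ∀ {b} → (∀ e → Upper K (f e) (b e)) → Upper K (feeTotal f X) (feeSum T X b)
    feeTotal-Upper up = ∑-Upper (nodePairs m) λ (i , j) → ∑-Upper (path i j) λ e →
      ·-Upper (indicator (X i j) * T [ i , j ]) (up e)

    feeTotal-Lower : ∀ {b} → (∀ e → Lower K (f e) (b e)) → Lower K (feeTotal f X) (feeSum T X b)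
    feeTotal-Lower low = ∑-Lower (nodePairs m) λ (i , j) → ∑-Lower (path i j) λ e →
      ·-Lower (indicator (X i j) * T [ i , j ]) (low e)

  -- The lower approximations `a` are rounded, while `a e + 3` bounds the fees from above; the
  -- difference is the fee sum of the constant 3, which does not involve K.
  feeTotal≤ : ∀ {opt} → (∀ b → W T b m ≤ opt) → ∀ g → Feasible g → (Y : Usage g) → Upper 0 (feeTotal g Y) opt
  feeTotal≤ {opt} W≤opt g feasible Y = Upper-limit (feeSum T Y (λ _ → 3)) bound
    where
    bound : ∀ K → Upper K (feeTotal g Y) (opt * suc K + feeSum T Y (λ _ → 3))
    bound K = Upper-mono (begin
      feeSum T Y (λ e → a e + 3)                  ≡⟨ feeSum-+ Y a (λ _ → 3) ⟩
      feeSum T Y a + feeSum T Y (λ _ → 3)         ≤⟨ ℕ.+-monoˡ-≤ _ (rounding T Y a K W≤opt short) ⟩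
      suc K * opt + feeSum T Y (λ _ → 3)          ≡⟨ cong (_+ feeSum T Y (λ _ → 3)) (ℕ.*-comm (suc K) opt) ⟩
      opt * suc K + feeSum T Y (λ _ → 3)          ∎)
      (feeTotal-Upper Y λ e → proj₂ (proj₂ (approx e)))
      where
      open ℕ.≤-Reasoning
      approx : ∀ e → ∃[ a ] Lower K (g e) a × Upper K (g e) (a + 3)
      approx e = approximation (g e) (proj₁ (feasible e)) (proj₂ (feasible e))
      a : Edge m → ℕ
      a e = proj₁ (approx e)
      -- Here the approximation has to be from below.
      short : ∀ i j → ∑ (path i j) g ≤ℝ 1ℝ → pathSum a (# i) (# j) ≤ suc K
      short i j used = subst (_≤ suc K) (∑ⁿ-path a i j)
        (Lower∧≤1⇒≤ (∑-Lower (path i j) λ e → proj₁ (proj₂ (approx e))) used)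

fees : ∀ {m} → EdgeSet m → FeeAssignment m
fees s = value (feesOf! s)

fee-Upper : ∀ b → Upper 0 (if b then 1ℝ else 0ℝ) (if b then 1 else 0)
fee-Upper true  = ≤⇒Upper {1ℝ} {1} (≤ℝ-refl 1ℝ)
fee-Upper false = 0-Upper

fee-Lower : ∀ b → Lower 0 (if b then 1ℝ else 0ℝ) (if b then 1 else 0)
fee-Lower true  = lower λ k → p≤p+1/suc (1 /suc 0) k
fee-Lower false = 0-Lower {0} {0ℝ} (≤ℝ-refl 0ℝ)

fee-feasible : ∀ b → 0ℝ ≤ℝ (if b then 1ℝ else 0ℝ) × (if b then 1ℝ else 0ℝ) ≤ℝ 1ℝ
fee-feasible b =
  Lower⇒≤ {if b then 1ℝ else 0ℝ} {0} (Lower-anti z≤n (fee-Lower b)) ,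
  Upper⇒≤ {if b then 1ℝ else 0ℝ} {1} (Upper-mono (≤1 b) (fee-Upper b))
  where
  ≤1 : ∀ b → (if b then 1 else 0) ≤ 1
  ≤1 true  = ℕ.≤-refl
  ≤1 false = z≤n

module _ {m : ℕ} (s : EdgeSet m) where

  fees-Upper : ∀ e → Upper 0 (fees s e) (weight s e)
  fees-Upper e = fee-Upper (does (e ∈? s))

  fees-Lower : ∀ e → Lower 0 (fees s e) (weight s e)
  fees-Lower e = fee-Lower (does (e ∈? s))

  fees-feasible : Feasible (fees s)
  fees-feasible e = fee-feasible (does (e ∈? s))

  -- The sum of such fees has the same integer as upper and lower bound, so the comparison with 1 is
  -- decided in ℕ.
  fees-usage : Usage (fees s)
  fees-usage i j = Dec.map′
    (λ ≤1 → Upper⇒≤ (Upper-mono ≤1 (∑-Upper (path i j) fees-Upper)))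
    (Lower∧≤1⇒≤ (∑-Lower (path i j) fees-Lower))
    (∑ⁿ (path i j) (weight s) ≤? 1)

  W≤feeTotal : ∀ T y → Lower 0 (feeTotal T (fees s) fees-usage) (W T (weight s) y)
  W≤feeTotal T y = Lower-anti
    (W≤feeSum T fees-usage (weight s) y λ i j one → Upper⇒≤ (subst (Upper 0 (∑ (path i j) (fees s)))
      (trans (∑ⁿ-path (weight s) i j) one) (∑-Upper (path i j) fees-Upper)))
    (feeTotal-Lower T fees-usage fees-Lower)

module _ {m : ℕ} (T : TransactionMatrix (suc m)) {opt : ℕ} (W≤opt : ∀ b → W T b m ≤ opt)
         (s : EdgeSet m) (attained : Lower 0 (feeTotal T (fees s) (fees-usage s)) opt) where

  fees-maximizeProfit : MaximizesProfit T (fees s)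
  fees-maximizeProfit = fees-feasible s , fees-usage s , λ g feasible Y →
    Upper∧Lower⇒+≤+ (fromℤ (ℤ.- (ℤ.+ m))) (feeTotal≤ T W≤opt g feasible Y) attained

  opt-isMaxRevenue : IsMaxRevenue T (fromℕ opt)
  opt-isMaxRevenue =
    (fees s , fees-feasible s , fees-usage s ,
      Lower⇒≤ (-m+x+m-Lower m _ attained) , revenue≤ (fees s) (fees-feasible s) (fees-usage s)) , revenue≤
    where
    revenue≤ : ∀ f → Feasible f → (X : Usage f) → revenue T f X ≤ℝ fromℕ opt
    revenue≤ f feasible X = Upper⇒≤ (-m+x+m-Upper m _ (feeTotal≤ T W≤opt f feasible X))

-- Stated for an arbitrary `best`, so that the equation `best ≡ just (x , y)` can be substituted
-- into the output.
output-correct : ∀ {m} → 1 ≤ m → (T : TransactionMatrix (suc m)) (P : Table² ℕ) (S : Table² (EdgeSet m)) →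
  (∀ {opt} → (∀ x → P (# x) m ≤ opt) → ∀ b → W T b m ≤ opt) →
  (∀ (x y : Edge m) → P (# x) (# y) ≤ W T (weight (S (# x) (# y))) (# y)) →
  ∀ best → (∀ {x y} → x Fin.≤ y → Attained P (P (# x) (# y)) best) →
  let r = value (output! (P , S) best) in MaximizesProfit T (proj₂ r) × IsMaxRevenue T (fromℕ (proj₁ r))
output-correct {m} 1≤m T P S W≤max P≤W best best-max = subst Correct (sym best≡)
  (fees-maximizeProfit T W≤opt s attained , opt-isMaxRevenue T W≤opt s attained)
  where
  Correct : Maybe (Edge m × Edge m) → Set
  Correct best = let r = value (output! (P , S) best) in
                 MaximizesProfit T (proj₂ r) × IsMaxRevenue T (fromℕ (proj₁ r))
  -- The pair (m, m) is in range, which rules out the result `nothing`; column m is also where the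
  -- upper bound is read off.
  last : Edge m
  last = proj₁ (edge-at m 1≤m ℕ.≤-refl)
  #last≡m : # last ≡ m
  #last≡m = proj₂ (edge-at m 1≤m ℕ.≤-refl)
  best-attained : Attained P (P (# last) (# last)) best
  best-attained = best-max ℕ.≤-refl
  x y : Edge m
  x = proj₁ best-attained
  y = proj₁ (proj₂ best-attained)
  best≡ : best ≡ just (x , y)
  best≡ = proj₁ (proj₂ (proj₂ best-attained))
  s : EdgeSet m
  s = S (# x) (# y)
  opt : ℕ
  opt = P (# x) (# y)
  P≤opt : ∀ e → P (# e) m ≤ opt
  P≤opt e with best-max {e} {last} (ℕ.≤-pred (subst (# e ≤_) (sym #last≡m) (Fin.toℕ<n e)))
  ... | _ , _ , best≡′ , le with trans (sym best≡) best≡′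
  ... | refl = subst (λ t → P (# e) t ≤ opt) #last≡m le
  W≤opt : ∀ b → W T b m ≤ opt
  W≤opt = W≤max P≤opt
  -- The selected column y may be smaller than m; the stored set still collects at least this much
  -- on the whole graph.
  attained : Lower 0 (feeTotal T (fees s) (fees-usage s)) opt
  attained = Lower-anti (P≤W x y) (W≤feeTotal s T (# y))

module _ {m : ℕ} (1≤m : 1 ≤ m) (T : TransactionMatrix (suc m)) (tie : TieRule m) where

  private
    M = value (computeM T)
    P = proj₁ (value (computePS {m} M))
    S = proj₂ (value (computePS {m} M))

    base : ∀ (x : Edge m) y → # x ≤ y → y ≤ m → crossing T 1 (# x) y ≤ P (# x) y
    base x y x≤y y≤m with edge-at y (ℕ.≤-trans (s≤s z≤n) x≤y) y≤m | edge-at {m} 1 ℕ.≤-refl 1≤m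
    base x _ (s≤s x≤y) y≤m | y , refl | e , #e≡1 = ℕ.≤-trans
      (ℕ.≤-reflexive (subst (λ i → crossing T i (# x) (# y) ≡ M i (# x) (# y)) #e≡1
        (sym (computeM-≡ T {e} (subst (_≤ toℕ x) (sym (ℕ.suc-injective #e≡1)) z≤n) x≤y))))
      (proj₁ (computePS-settles M x≤y))

    step : ∀ (x : Edge m) y → # x ≤ y → y ≤ m → ∀ (ℓ : Edge m) → # ℓ < # x →
           P (# ℓ) (toℕ x) + crossing T (# ℓ + 1) (# x) y ≤ P (# x) y
    step x y x≤y y≤m ℓ ℓ<x
      with edge-at y (ℕ.≤-trans (s≤s z≤n) x≤y) y≤m
         | edge-at {m} (# ℓ + 1) (ℕ.m≤n+m 1 (# ℓ))
             (ℕ.≤-trans (ℕ.≤-reflexive (ℕ.+-comm (# ℓ) 1)) (ℕ.≤-trans ℓ<x (Fin.toℕ<n x)))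
    step x _ (s≤s x≤y) y≤m ℓ ℓ<x | y , refl | e , #e≡ℓ+1 = ℕ.≤-trans
      (ℕ.≤-reflexive (cong (P (# ℓ) (toℕ x) +_) (subst (λ i → crossing T i (# x) (# y) ≡ M i (# x) (# y)) #e≡ℓ+1
        (sym (computeM-≡ T {e} (ℕ.≤-pred (subst (_≤ # x) (trans (ℕ.+-comm 1 (# ℓ)) (sym #e≡ℓ+1)) ℓ<x)) x≤y)))))
      (proj₂ (computePS-settles M x≤y) ℓ (ℕ.≤-pred ℓ<x))

    P≤W : ∀ (x y : Edge m) → P (# x) (# y) ≤ W T (weight (S (# x) (# y))) (# y)
    P≤W x y = proj₁ (computePS-sound M T (computeM-≤ T) (# x) (# y))

  dynamicProgram-correct : let r = value (dynamicProgram tie T) in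
                           MaximizesProfit T (proj₂ r) × IsMaxRevenue T (fromℕ (proj₁ r))
  dynamicProgram-correct = output-correct 1≤m T P S (W≤max T P base step 1≤m) P≤W
    (value (selectMax tie P)) (selectMax-max tie P)


theorem2 : (∀ (m : ℕ) → let n = suc m in
    2 ≤ n → (T : TransactionMatrix n) (tie : TieRule m) →
    MaximizesProfit T (proj₂ (value (dynamicProgram tie T))) ×
    IsMaxRevenue T (fromℕ (proj₁ (value (dynamicProgram tie T))))) ×
    (∃[ C ] (∀ (m : ℕ) → let n = suc m in
    2 ≤ n → (T : TransactionMatrix n) (tie : TieRule m) →
    time (dynamicProgram tie T) ≤ C * n ^ 5))
theorem2 =
  (λ m 2≤n T tie → dynamicProgram-correct (ℕ.≤-pred 2≤n) T tie) ,
  29 , λ m _ T tie → dynamicProgram-time m tie T
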